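{- Let $F$ be an oriented tree of order $n$ and $k$ a positive integer. Every tournament on at least $2^{10+18k}\,k\,n$ vertices contains $F[k]$.
   Context: An oriented tree is an orientation of a tree. The $k$-blow-up $D[k]$ of a digraph $D$ has vertex set $\{(v,i): v\in V(D), i\in[k]\}$ and arc set $\{(u,i)(v,j): uv\in A(D), i,j\in[k]\}$, i.e. each vertex $u$ is replaced by an independent set $X_u$ of size $k$ and each arc $uv$ by all arcs from $X_u$ to $X_v$. A tournament contains a digraph if it has a subdigraph isomorphic to it. -}

module Defs where

open import Data.Nat using (ℕ; suc; _+_)
open import Data.Fin using (Fin; zero; suc; inject₁; fromℕ)
open import Data.Product using (_×_; _,_; ∃)
open import Data.Sum using (_⊎_)
open import Data.Empty using (⊥)
open import Relation.Nullary using (¬_)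
open import Relation.Binary.PropositionalEquality using (_≡_)
open import Function.Definitions using (Injective)

Digraph : ℕ → Set₁
Digraph n = Fin n → Fin n → Set

IsTournament : ∀ {N} → Digraph N → Set
IsTournament {N} T =
  (∀ u → ¬ T u u) ×
  (∀ u v → ¬ u ≡ v → T u v ⊎ T v u) ×
  (∀ u v → T u v → ¬ T v u)

IsOriented : ∀ {n} → Digraph n → Set
IsOriented {n} D = (∀ u → ¬ D u u) × (∀ u v → D u v → ¬ D v u)

Adj : ∀ {n} → Digraph n → Fin n → Fin n → Set
Adj D u v = D u v ⊎ D v u

data Walk {n} (D : Digraph n) : Fin n → Fin n → Set where
  here : ∀ {u} → Walk D u u
  step : ∀ {u v w} → Adj D u v → Walk D v w → Walk D u w

Connected : ∀ {n} → Digraph n → Set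
Connected {n} D = ∀ (u v : Fin n) → Walk D u v

Cycle : ∀ {n} → Digraph n → ℕ → Set
Cycle {n} D m =
  ∃ λ (c : Fin (3 + m) → Fin n) →
    Injective _≡_ _≡_ c ×
    (∀ (i : Fin (2 + m)) → Adj D (c (inject₁ i)) (c (suc i))) ×
    Adj D (c (fromℕ (2 + m))) (c zero)

Acyclic : ∀ {n} → Digraph n → Set
Acyclic D = ∀ m → ¬ Cycle D m

IsOrientedTree : ∀ {n} → Digraph n → Set
IsOrientedTree {n} D = IsOriented D × Connected D × Acyclic D

BlowUp : ∀ {n} → Digraph n → (k : ℕ) → Fin n × Fin k → Fin n × Fin k → Set
BlowUp D k (u , i) (v , j) = D u v

Contains : ∀ {N} {V : Set} → Digraph N → (V → V → Set) → Set
Contains {N} {V} T H =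
  ∃ λ (f : V → Fin N) → Injective _≡_ _≡_ f × (∀ x y → H x y → T (f x) (f y))

module Submission where

open import Defs
open import Algebra.Bundles using (CommutativeMonoid)
import Algebra.Properties.CommutativeSemigroup as CommutativeSemigroupProperties
open import Data.Bool using (Bool; true; false; _∧_; _∨_; not; T?; if_then_else_)
open import Data.Bool.ListAction using (all)
open import Data.Bool.Properties using (T-≡; ∧-assoc)
open import Data.Fin using (Fin; zero; suc; inject₁; fromℕ; fromℕ<; toℕ)
open import Data.Fin.Properties using (injective⇒≤; toℕ<n; toℕ-injective) renaming (_≟_ to _≟ᶠ_)
open import Data.List using (List; []; _∷_; _++_; [_]; length; map; take; filterᵇ; cartesianProduct; lookup; allFin)
open import Data.List.Properties using (length-map; length-++; length-take; length-tabulate; map-++; ++-assoc; ++-identityʳ)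
open import Data.List.Membership.DecPropositional using () renaming (_∈?_ to member?)
open import Data.List.Membership.Propositional using (_∈_; _∉_)
open import Data.List.Membership.Propositional.Properties
  using (∈-++⁺ˡ; ∈-++⁺ʳ; ∈-++⁻; ∈-filter⁻; ∈-lookup; ∈-allFin)
open import Data.List.Relation.Binary.Permutation.Propositional
  using (_↭_; refl; prep; swap; trans; ↭-refl; ↭-trans; ↭-sym; ↭-reflexive; ↭⇒↭ₛ)
open import Data.List.Relation.Binary.Permutation.Propositional.Properties
  using (shift; ++⁺; ++⁺ˡ; ++⁺ʳ; ++-commutativeMonoid; ∈-resp-↭; ↭-length)
open import Data.List.Relation.Binary.Permutation.Setoid.Properties using (Unique-resp-↭)
open import Data.List.Relation.Binary.Sublist.Propositional
  using (_⊆_; []; _∷_; _∷ʳ_; minimum; ⊆-trans) renaming (lookup to ⊆-lookup)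
open import Data.List.Relation.Binary.Sublist.Propositional.Properties using (take-⊆; filter-⊆)
open import Data.List.Relation.Unary.All as All using (All; []; _∷_)
open import Data.List.Relation.Unary.All.Properties using () renaming (++⁻ to All-++⁻)
open import Data.List.Relation.Unary.AllPairs using ([]; _∷_)
open import Data.List.Relation.Unary.Any using (here; there)
open import Data.List.Relation.Unary.Unique.Propositional using (Unique)
open import Data.List.Relation.Unary.Unique.Propositional.Properties using (allFin⁺) renaming (++⁺ to Unique-++⁺)
open import Data.Nat
  using (ℕ; zero; suc; _+_; _*_; _∸_; _^_; _≤_; _<_; _≤?_; _<?_; _≤ᵇ_; _<ᵇ_; _≡ᵇ_; z≤n; s≤s; s≤s⁻¹; >-nonZero)
open import Data.Nat.ListAction using (sum)
open import Data.Nat.Properties hiding (_≟_)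
open import Data.Nat.Tactic.RingSolver using (solve-∀)
open import Data.Product using (_×_; _,_; ∃; ∃₂; proj₁; proj₂)
open import Data.Sum using (_⊎_; inj₁; inj₂; [_,_]′) renaming (swap to ⊎-swap)
open import Function using (_∘_; Equivalence)
open import Relation.Binary.PropositionalEquality as ≡
  using (_≡_; _≢_; refl; sym; cong; cong₂; subst; subst₂)
open import Relation.Nullary using (yes; no; contradiction)

-- Order the tournament by a local median order and cut it into cells of W
-- consecutive positions.  The tree is embedded from its root, the region in use
-- growing in both directions at a rate so large that each of its suffixes and
-- prefixes stays sparsely used.  All children of a vertex are placed at the same
-- moment.  This moment is known in advance, so the k-set of the vertex only needs
-- dense common neighbourhoods at one scale: a Kővári–Sós–Turán count over pairs
-- (in-neighbour, out-neighbour) finds it inside 8k candidates of a single cell,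
-- because in a median order every vertex dominates almost half of the region to
-- its right and is dominated by almost half of the region to its left.

-- A set in cell `c` seeks its out-children only in the cells after `c` and its in-children only
-- before, so a bound on the total use of the region would not do: the used share of that very
-- suffix or prefix must stay below the density of the common neighbourhood. Common neighbourhoods
-- have density at least `1 / Q` with `Q = 16 * 2 ^ s`, used positions at most `1 / (2 Q)`; the free
-- common neighbours that remain average `W / (2 Q) = s = 8 k` per cell, so some cell supplies all
-- candidates for a child. Candidates from one cell have the same windows on both sides up to an
-- error of one cell, and windows of at least 8 cells absorb this error, turning one half into 7/16.
-- Counting pairs instead of two separate neighbourhoods yields one `k`-set that is good in both
-- directions, whichever way the arcs to its children go.

private variable
  A V Z : Set

-- Counting in lists and in ranges of positions.

toℕᵇ : Bool → ℕ
toℕᵇ b = if b then 1 else 0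

count : (A → Bool) → List A → ℕ
count p []       = 0
count p (x ∷ xs) = toℕᵇ (p x) + count p xs

range : ℕ → ℕ → List ℕ
range a zero    = []
range a (suc ℓ) = a ∷ range (suc a) ℓ

∧-true : ∀ {a b} → a ∧ b ≡ true → a ≡ true × b ≡ true
∧-true {true} {true} _ = refl , refl

≤ᵇ-true : ∀ {m n} → m ≤ n → (m ≤ᵇ n) ≡ true
≤ᵇ-true = Equivalence.to T-≡ ∘ ≤⇒≤ᵇ

true-≤ᵇ : ∀ {m n} → (m ≤ᵇ n) ≡ true → m ≤ n
true-≤ᵇ {m} = ≤ᵇ⇒≤ m _ ∘ Equivalence.from T-≡

toℕᵇ≤1 : ∀ b → toℕᵇ b ≤ 1
toℕᵇ≤1 true  = ≤-refl
toℕᵇ≤1 false = z≤n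

toℕᵇ-mono : ∀ {a b} → (a ≡ true → b ≡ true) → toℕᵇ a ≤ toℕᵇ b
toℕᵇ-mono {false} _ = z≤n
toℕᵇ-mono {true}  f = ≤-reflexive (cong toℕᵇ (sym (f refl)))

count-++ : ∀ (p : A → Bool) xs ys → count p (xs ++ ys) ≡ count p xs + count p ys
count-++ p []       ys = refl
count-++ p (x ∷ xs) ys = ≡.trans (cong (toℕᵇ (p x) +_) (count-++ p xs ys))
  (sym (+-assoc (toℕᵇ (p x)) _ _))

count≤length : ∀ (p : A → Bool) xs → count p xs ≤ length xs
count≤length p []       = z≤n
count≤length p (x ∷ xs) = +-mono-≤ (toℕᵇ≤1 (p x)) (count≤length p xs)

count-mono : ∀ {p q : A → Bool} xs → (∀ {x} → x ∈ xs → p x ≡ true → q x ≡ true) →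
  count p xs ≤ count q xs
count-mono []       f = z≤n
count-mono (x ∷ xs) f = +-mono-≤ (toℕᵇ-mono (f (here refl))) (count-mono xs (f ∘ there))

count-none : ∀ {p : A → Bool} xs → (∀ {x} → x ∈ xs → p x ≡ false) → count p xs ≡ 0
count-none []       f = refl
count-none (x ∷ xs) f rewrite f (here refl) = count-none xs (f ∘ there)

count-all : ∀ {p : A → Bool} xs → (∀ {x} → x ∈ xs → p x ≡ true) → count p xs ≡ length xs
count-all []       f = refl
count-all (x ∷ xs) f rewrite f (here refl) = cong suc (count-all xs (f ∘ there))

count-↭ : ∀ (p : A → Bool) {xs ys} → xs ↭ ys → count p xs ≡ count p ys
count-↭ p refl          = refl
count-↭ p (prep x e)    = cong (toℕᵇ (p x) +_) (count-↭ p e)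
count-↭ p (swap x y e)  rewrite count-↭ p e =
  (λ a b c → solve-swap a b c) (toℕᵇ (p x)) (toℕᵇ (p y)) _
  where
  solve-swap : ∀ a b c → a + (b + c) ≡ b + (a + c)
  solve-swap = solve-∀
count-↭ p (trans e₁ e₂) = ≡.trans (count-↭ p e₁) (count-↭ p e₂)

count-map : ∀ (p : Z → Bool) (f : A → Z) xs → count p (map f xs) ≡ count (p ∘ f) xs
count-map p f []       = refl
count-map p f (x ∷ xs) = cong (toℕᵇ (p (f x)) +_) (count-map p f xs)

count-filterᵇ : ∀ (p : A → Bool) xs → length (filterᵇ p xs) ≡ count p xs
count-filterᵇ p []       = refl
count-filterᵇ p (x ∷ xs) with p x
... | true  = cong suc (count-filterᵇ p xs)
... | false = count-filterᵇ p xs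

length-range : ∀ a ℓ → length (range a ℓ) ≡ ℓ
length-range a zero    = refl
length-range a (suc ℓ) = cong suc (length-range (suc a) ℓ)

range-++ : ∀ a m n → range a (m + n) ≡ range a m ++ range (a + m) n
range-++ a zero    n = cong (λ z → range z n) (sym (+-identityʳ a))
range-++ a (suc m) n = cong (a ∷_) (≡.trans (range-++ (suc a) m n)
  (cong (λ z → range (suc a) m ++ range z n) (sym (+-suc a m))))

∈-range⁻ : ∀ {x} a ℓ → x ∈ range a ℓ → a ≤ x × x < a + ℓ
∈-range⁻ a (suc ℓ) (here refl) = ≤-refl , m<m+n a (s≤s z≤n)
∈-range⁻ {x} a (suc ℓ) (there x∈) with ∈-range⁻ (suc a) ℓ x∈
... | a<x , x< = <⇒≤ a<x , subst (x <_) (sym (+-suc a ℓ)) x<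

range-unique : ∀ a ℓ → Unique (range a ℓ)
range-unique a zero    = []
range-unique a (suc ℓ) =
  All.tabulate (λ x∈ a≡x → <⇒≢ (proj₁ (∈-range⁻ (suc a) ℓ x∈)) a≡x) ∷ range-unique (suc a) ℓ

-- Avoiding used positions and finding a rich cell.

notElem : ℕ → List ℕ → Bool
notElem y = all (λ u → not (u ≡ᵇ y))

≡ᵇ-true : ∀ m n → (m ≡ᵇ n) ≡ true → m ≡ n
≡ᵇ-true m n = ≡ᵇ⇒≡ m n ∘ Equivalence.from T-≡

≡ᵇ-refl : ∀ n → (n ≡ᵇ n) ≡ true
≡ᵇ-refl n = Equivalence.to T-≡ (≡⇒≡ᵇ n n refl)

notElem-∉ : ∀ {y} U → notElem y U ≡ true → y ∉ U
notElem-∉ {y} (u ∷ U) e (here refl) with y ≡ᵇ y | ≡ᵇ-refl y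
notElem-∉ {y} (u ∷ U) () (here refl) | true | _
notElem-∉ {y} (u ∷ U) e (there y∈) = notElem-∉ U (proj₂ (∧-true {not (u ≡ᵇ y)} e)) y∈

count-single : ∀ (q : ℕ → Bool) u xs → Unique xs → (∀ {x} → x ∈ xs → q x ≡ true) →
  count (u ≡ᵇ_) xs ≤ toℕᵇ (q u)
count-single q u []       _         f = z≤n
count-single q u (x ∷ xs) (x∉ ∷ un) f with u ≡ᵇ x in e
... | false = count-single q u xs un (f ∘ there)
... | true rewrite ≡ᵇ-true u x e | f (here refl) = s≤s (≤-reflexive (count-none xs ne))
  where
  ne : ∀ {y} → y ∈ xs → (x ≡ᵇ y) ≡ false
  ne {y} y∈ with x ≡ᵇ y in e′
  ... | false = refl
  ... | true  = contradiction (≡ᵇ-true x y e′) (All.lookup x∉ y∈)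

-- Since `q` holds throughout `xs`, only entries of `U` satisfying `q` can spoil anything. In use
-- `q` cuts out a half-line, so that only the used part of a suffix or prefix is charged.
count-avoid : ∀ (p q : ℕ → Bool) xs U → Unique xs → (∀ {x} → x ∈ xs → q x ≡ true) →
  count p xs ≤ count (λ x → p x ∧ notElem x U) xs + count q U
count-avoid p q xs [] un f = ≤-trans
  (count-mono xs (λ {x} _ e → subst (λ b → b ∧ true ≡ true) (sym e) refl)) (m≤m+n _ 0)
count-avoid p q xs (u ∷ U) un f = begin
  count p xs                                          ≤⟨ count-avoid p q xs U un f ⟩
  count (λ x → p x ∧ notElem x U) xs + count q U       ≤⟨ +-monoˡ-≤ _ (split xs) ⟩
  (c + count (u ≡ᵇ_) xs) + count q U                  ≤⟨ +-monoˡ-≤ _ (+-monoʳ-≤ c (count-single q u xs un f)) ⟩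
  (c + toℕᵇ (q u)) + count q U                        ≡⟨ +-assoc c _ _ ⟩
  c + (toℕᵇ (q u) + count q U)                        ∎
  where
  open ≤-Reasoning
  c : ℕ
  c = count (λ x → p x ∧ notElem x (u ∷ U)) xs
  pw : ∀ a b e → toℕᵇ (a ∧ b) ≤ toℕᵇ (a ∧ (not e ∧ b)) + toℕᵇ e
  pw false b     e     = z≤n
  pw true  false e     = z≤n
  pw true  true  false = s≤s z≤n
  pw true  true  true  = s≤s z≤n
  rearr : ∀ a b m n → (a + b) + (m + n) ≡ (a + m) + (b + n)
  rearr = solve-∀
  split : ∀ ys → count (λ x → p x ∧ notElem x U) ys ≤
    count (λ x → p x ∧ notElem x (u ∷ U)) ys + count (u ≡ᵇ_) ys
  split []       = z≤n
  split (y ∷ ys) = ≤-trans (+-mono-≤ (pw (p y) (notElem y U) (u ≡ᵇ y)) (split ys))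
    (≤-reflexive (rearr (toℕᵇ (p y ∧ notElem y (u ∷ U))) _ _ _))

count-× : ∀ {B : Set} (p : A → Bool) (q : B → Bool) xs ys →
  count (λ z → p (proj₁ z) ∧ q (proj₂ z)) (cartesianProduct xs ys) ≡ count p xs * count q ys
count-× p q []       ys = refl
count-× p q (x ∷ xs) ys = ≡.trans
  (count-++ _ (map (x ,_) ys) (cartesianProduct xs ys))
  (≡.trans (cong₂ _+_ (≡.trans (count-map _ (x ,_) ys) row) (count-× p q xs ys))
           (sym (*-distribʳ-+ (count q ys) (toℕᵇ (p x)) (count p xs))))
  where
  row : count (λ y → p x ∧ q y) ys ≡ toℕᵇ (p x) * count q ys
  row with p x
  ... | true  = sym (*-identityˡ _)
  ... | false = count-none ys (λ _ → refl)

-- A first cell with fewer than `s` hits leaves the other cells with an average of at least `s`.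
-- This turns a density bound into candidates that share one cell.
pigeonhole : ∀ (p : ℕ → Bool) W s m a → m * s ≤ count p (range (a * W) (m * W)) → 1 ≤ m →
  ∃ λ j → j < m × s ≤ count p (range ((a + j) * W) W)
pigeonhole p W s (suc m) a h _ with s ≤? count p (range (a * W) W)
... | yes s≤ = 0 , s≤s z≤n , subst (λ z → s ≤ count p (range (z * W) W)) (sym (+-identityʳ a)) s≤
... | no s≰ with m
...   | zero = contradiction
          (subst₂ _≤_ (*-identityˡ s) (cong (λ z → count p (range (a * W) z)) (*-identityˡ W)) h) s≰
...   | suc m′ with pigeonhole p W s (suc m′) (suc a) rest (s≤s z≤n)
  where
  open ≤-Reasoning
  first rem : ℕ
  first = count p (range (a * W) W)
  rem   = count p (range (suc a * W) (suc m′ * W))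
  split : count p (range (a * W) (suc (suc m′) * W)) ≡ first + rem
  split = ≡.trans (cong (count p) (range-++ (a * W) W (suc m′ * W)))
    (≡.trans (count-++ p (range (a * W) W) _)
      (cong (λ z → first + count p (range z (suc m′ * W))) (+-comm (a * W) W)))
  rest : suc m′ * s ≤ rem
  rest = +-cancelˡ-≤ s _ _ (begin
    s + suc m′ * s ≤⟨ h ⟩
    _              ≡⟨ split ⟩
    first + rem    ≤⟨ +-monoˡ-≤ rem (<⇒≤ (≰⇒> s≰)) ⟩
    s + rem        ∎)
...   | j , j< , s≤ = suc j , s≤s j< , subst (λ z → s ≤ count p (range (z * W) W)) (sym (+-suc a j)) s≤

-- The Kővári-Sós-Turán count.

degree : (V → Z → Bool) → List V → Z → ℕ
degree r S z = count (λ v → r v z) S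

commonᵇ : (V → Z → Bool) → List V → Z → Bool
commonᵇ r X z = all (λ v → r v z) X

-- Halving: according to whether the majority of the good z is adjacent to the
-- head of S, that vertex is selected or discarded.
select-common : (r : V → Z → Bool) (zs : List Z) (k : ℕ) (S : List V) (p : Z → Bool) →
  1 ≤ count (λ z → p z ∧ (k ≤ᵇ degree r S z)) zs →
  ∃ λ X → X ⊆ S × length X ≡ k ×
    count (λ z → p z ∧ (k ≤ᵇ degree r S z)) zs ≤ 2 ^ length S * count (λ z → p z ∧ commonᵇ r X z) zs
select-common r zs zero S p _ = [] , minimum S , refl ,
  ≤-trans (≤-reflexive (sym (*-identityˡ _))) (*-monoˡ-≤ _ (m^n>0 2 (length S)))
select-common r zs (suc k) [] p h = contradiction h (<⇒≱ (s≤s (≤-reflexive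
  (count-none {p = λ z → p z ∧ false} zs (λ {z} _ → ∧-f (p z))))))
  where
  ∧-f : ∀ a → a ∧ false ≡ false
  ∧-f true  = refl
  ∧-f false = refl
select-common {V} {Z} r zs (suc k) (x ∷ S) p h = go (≤-total c₂ c₁)
  where
  c c₁ c₂ : ℕ
  c  = count (λ z → p z ∧ (suc k ≤ᵇ degree r (x ∷ S) z)) zs
  c₁ = count (λ z → (p z ∧ r x z) ∧ (k ≤ᵇ degree r S z)) zs
  c₂ = count (λ z → p z ∧ (suc k ≤ᵇ degree r S z)) zs
  -- A `z` with `suc k` neighbours in `x ∷ S` is adjacent to `x` and has `k` neighbours in `S`, or
  -- it has `suc k` in `S`. In the first case `p` absorbs the adjacency to `x`.
  pw : ∀ a b d → toℕᵇ (a ∧ (suc k ≤ᵇ toℕᵇ b + d)) ≤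
    toℕᵇ ((a ∧ b) ∧ (k ≤ᵇ d)) + toℕᵇ (a ∧ (suc k ≤ᵇ d))
  pw false b     d = z≤n
  pw true  false d = ≤-refl
  pw true  true  d = ≤-trans
    (toℕᵇ-mono (λ e → ≤ᵇ-true (s≤s⁻¹ (true-≤ᵇ {suc k} {suc d} e)))) (m≤m+n _ _)
  rearr : ∀ a b m n → (a + b) + (m + n) ≡ (a + m) + (b + n)
  rearr = solve-∀
  split : ∀ ys → count (λ z → p z ∧ (suc k ≤ᵇ degree r (x ∷ S) z)) ys ≤
    count (λ z → (p z ∧ r x z) ∧ (k ≤ᵇ degree r S z)) ys +
    count (λ z → p z ∧ (suc k ≤ᵇ degree r S z)) ys
  split []       = z≤n
  split (y ∷ ys) = ≤-trans (+-mono-≤ (pw (p y) (r x y) (degree r S y)) (split ys))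
    (≤-reflexive (rearr (toℕᵇ ((p y ∧ r x y) ∧ (k ≤ᵇ degree r S y))) _ _ _))
  double : ∀ m → m + m ≡ 2 * m
  double = solve-∀
  pos : ∀ {m n} → 1 ≤ m + n → n ≤ m → 1 ≤ m
  pos {zero}  {zero} ()
  pos {suc m} _ _ = s≤s z≤n
  doubled : ∀ {m n} → m ≤ 2 ^ length S * n → 2 * m ≤ 2 ^ suc (length S) * n
  doubled {m} {n} h′ = ≤-trans (*-monoʳ-≤ 2 h′) (≤-reflexive (sym (*-assoc 2 (2 ^ length S) n)))
  go : c₂ ≤ c₁ ⊎ c₁ ≤ c₂ → ∃ λ X → X ⊆ x ∷ S × length X ≡ suc k ×
    c ≤ 2 ^ suc (length S) * count (λ z → p z ∧ commonᵇ r X z) zs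
  go (inj₁ le) with select-common r zs k S (λ z → p z ∧ r x z) (pos (≤-trans h (split zs)) le)
  ... | X , X⊆ , len , b = x ∷ X , refl ∷ X⊆ , cong suc len ,
    (begin
      c              ≤⟨ split zs ⟩
      c₁ + c₂        ≤⟨ +-monoʳ-≤ c₁ le ⟩
      c₁ + c₁        ≡⟨ double c₁ ⟩
      2 * c₁         ≤⟨ doubled b ⟩
      2 ^ suc (length S) * count (λ z → (p z ∧ r x z) ∧ commonᵇ r X z) zs
                     ≤⟨ *-monoʳ-≤ (2 ^ suc (length S)) (count-mono zs (λ {z} _ e →
                          ≡.trans (sym (∧-assoc (p z) (r x z) _)) e)) ⟩
      2 ^ suc (length S) * count (λ z → p z ∧ commonᵇ r (x ∷ X) z) zs ∎)
    where open ≤-Reasoning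
  go (inj₂ le) with select-common r zs (suc k) S p
      (pos {c₂} {c₁} (subst (1 ≤_) (+-comm c₁ c₂) (≤-trans h (split zs))) le)
  ... | X , X⊆ , len , b = X , x ∷ʳ X⊆ , len ,
    (begin
      c              ≤⟨ split zs ⟩
      c₁ + c₂        ≤⟨ +-monoˡ-≤ c₂ le ⟩
      c₂ + c₂        ≡⟨ double c₂ ⟩
      2 * c₂         ≤⟨ doubled b ⟩
      2 ^ suc (length S) * count (λ z → p z ∧ commonᵇ r X z) zs ∎)
    where open ≤-Reasoning

-- Double counting: a `z` of degree below `k` contributes at most `k`, any other at most `length S`.
sum-counts≤ : (r : V → Z → Bool) (S : List V) (k : ℕ) (zs : List Z) →
  sum (map (λ v → count (r v) zs) S) ≤
  k * length zs + length S * count (λ z → k ≤ᵇ degree r S z) zs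
sum-counts≤ r S k [] = ≤-trans (≤-reflexive (zeros S)) z≤n
  where
  zeros : ∀ S → sum (map (λ v → count (r v) []) S) ≡ 0
  zeros []      = refl
  zeros (_ ∷ S) = zeros S
sum-counts≤ r S k (z ∷ zs) = begin
  sum (map (λ v → count (r v) (z ∷ zs)) S)              ≡⟨ split S ⟩
  degree r S z + sum (map (λ v → count (r v) zs) S)      ≤⟨ +-mono-≤ deg≤ (sum-counts≤ r S k zs) ⟩
  (k + length S * g) + (k * length zs + length S * G)   ≡⟨ rearr k (length S) g (length zs) G ⟩
  k * suc (length zs) + length S * (g + G)              ∎
  where
  open ≤-Reasoning
  g G : ℕ
  g = toℕᵇ (k ≤ᵇ degree r S z)
  G = count (λ z → k ≤ᵇ degree r S z) zs
  swap₄ : ∀ a b m n → (a + b) + (m + n) ≡ (a + m) + (b + n)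
  swap₄ = solve-∀
  rearr : ∀ k s g l G → (k + s * g) + (k * l + s * G) ≡ k * suc l + s * (g + G)
  rearr = solve-∀
  split : ∀ S → sum (map (λ v → count (r v) (z ∷ zs)) S) ≡
    degree r S z + sum (map (λ v → count (r v) zs) S)
  split []      = refl
  split (v ∷ S) = ≡.trans (cong (toℕᵇ (r v z) + count (r v) zs +_) (split S))
    (swap₄ (toℕᵇ (r v z)) _ _ _)
  deg≤ : degree r S z ≤ k + length S * g
  deg≤ with k ≤? degree r S z
  ... | yes k≤ rewrite ≤ᵇ-true k≤ = ≤-trans (count≤length _ S)
    (≤-trans (≤-reflexive (sym (*-identityʳ (length S)))) (m≤n+m _ k))
  ... | no  k≰ = ≤-trans (<⇒≤ (≰⇒> k≰)) (m≤m+n k _)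

sum-lower : ∀ (f : V → ℕ) a b S → (∀ {v} → v ∈ S → a ≤ b * f v) → length S * a ≤ b * sum (map f S)
sum-lower f a b []      h = z≤n
sum-lower f a b (v ∷ S) h = ≤-trans (+-mono-≤ (h (here refl)) (sum-lower f a b S (h ∘ there)))
  (≤-reflexive (sym (*-distribˡ-+ b (f v) _)))

-- List entries by position.

-- The default keeps positions plain natural numbers, so that cell arithmetic carries no bound
-- proofs; below the length it is never returned.
nth : A → List A → ℕ → A
nth d []       _       = d
nth d (x ∷ xs) zero    = x
nth d (x ∷ xs) (suc i) = nth d xs i

nth-∈ : ∀ (d : A) xs {i} → i < length xs → nth d xs i ∈ xs
nth-∈ d (x ∷ xs) {zero}  _       = here refl
nth-∈ d (x ∷ xs) {suc i} (s≤s h) = there (nth-∈ d xs h)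

nth-injective : ∀ (d : A) {xs} → Unique xs → ∀ {i j} → i < length xs → j < length xs →
  nth d xs i ≡ nth d xs j → i ≡ j
nth-injective d (_ ∷ _)       {zero}  {zero}  _       _       _ = refl
nth-injective d {x ∷ xs} (x∉ ∷ un) {zero}  {suc j} _  (s≤s h) e =
  contradiction e (All.lookup x∉ (nth-∈ d xs h))
nth-injective d {x ∷ xs} (x∉ ∷ un) {suc i} {zero}  (s≤s h) _  e =
  contradiction (sym e) (All.lookup x∉ (nth-∈ d xs h))
nth-injective d (_ ∷ un)      {suc i} {suc j} (s≤s h) (s≤s h′) e =
  cong suc (nth-injective d un h h′ e)

map-nth-suc : ∀ (d : A) x xs a ℓ →
  map (nth d (x ∷ xs)) (range (suc a) ℓ) ≡ map (nth d xs) (range a ℓ)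
map-nth-suc d x xs a zero    = refl
map-nth-suc d x xs a (suc ℓ) = cong (nth d xs a ∷_) (map-nth-suc d x xs (suc a) ℓ)

-- The bridge between the two views of an order: exchanges speak of list decompositions, the
-- embedding of ranges of positions.
segment : ∀ (d : A) xs a ℓ → a + ℓ ≤ length xs →
  ∃₂ λ pre post → xs ≡ pre ++ map (nth d xs) (range a ℓ) ++ post
segment d xs       zero    zero    _       = [] , xs , refl
segment d (x ∷ xs) zero    (suc ℓ) (s≤s h) with segment-prefix xs ℓ h
  where
  segment-prefix : ∀ xs ℓ → ℓ ≤ length xs → ∃ λ post → xs ≡ map (nth d xs) (range 0 ℓ) ++ post
  segment-prefix xs       zero    _       = xs , refl
  segment-prefix (x ∷ xs) (suc ℓ) (s≤s h) with segment-prefix xs ℓ h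
  ... | post , e = post , cong (x ∷_) (≡.trans e (cong (_++ post) (sym (map-nth-suc d x xs 0 ℓ))))
... | post , e = [] , post , cong (x ∷_) (≡.trans e (cong (_++ post) (sym (map-nth-suc d x xs 0 ℓ))))
segment d (x ∷ xs) (suc a) ℓ       (s≤s h) with segment d xs a ℓ h
... | pre , post , e = x ∷ pre , post ,
  cong (x ∷_) (≡.trans e (cong (λ z → pre ++ z ++ post) (sym (map-nth-suc d x xs a ℓ))))
segment d [] (suc a) ℓ ()

Unique-++ : ∀ {xs ys : List A} → Unique (xs ++ ys) →
  Unique xs × Unique ys × (∀ {x} → x ∈ xs → x ∉ ys)
Unique-++ {xs = []}     un        = [] , un , λ ()
Unique-++ {xs = x ∷ xs} (x∉ ∷ un) with Unique-++ {xs = xs} un | All-++⁻ xs x∉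
... | u₁ , u₂ , dj | x∉xs , x∉ys = x∉xs ∷ u₁ , u₂ ,
  λ { (here refl) ∈ys → All.lookup x∉ys ∈ys refl ; (there ∈xs) ∈ys → dj ∈xs ∈ys }

-- Local median orders.

<ᵇ-true : ∀ {m n} → m < n → (m <ᵇ n) ≡ true
<ᵇ-true {m} = ≤ᵇ-true {suc m}

true-<ᵇ : ∀ {m n} → (m <ᵇ n) ≡ true → m < n
true-<ᵇ {m} = true-≤ᵇ {suc m}

find-prefix : (P : List A → List A → Bool) (xs : List A) →
  (∃₂ λ mid post → xs ≡ mid ++ post × P mid post ≡ true) ⊎
  (∀ mid post → xs ≡ mid ++ post → P mid post ≡ false)
find-prefix P xs with P [] xs in e
... | true = inj₁ ([] , xs , refl , e)
find-prefix P []       | false = inj₂ λ { [] [] refl → e }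
find-prefix P (x ∷ xs) | false with find-prefix (λ mid post → P (x ∷ mid) post) xs
... | inj₁ (mid , post , refl , h) = inj₁ (x ∷ mid , post , refl , h)
... | inj₂ h = inj₂ λ { [] _ refl → e ; (_ ∷ mid) post refl → h mid post refl }

-- With a Boolean test, an unsuccessful search is itself the proof of local optimality.
find-infix : (P : List A → List A → Bool) (xs : List A) →
  (∃ λ pre → ∃₂ λ mid post → xs ≡ pre ++ mid ++ post × P mid post ≡ true) ⊎
  (∀ pre mid post → xs ≡ pre ++ mid ++ post → P mid post ≡ false)
find-infix P xs with find-prefix P xs
... | inj₁ (mid , post , e , h) = inj₁ ([] , mid , post , e , h)
find-infix P []       | inj₂ h = inj₂ λ { [] mid post e → h mid post e }
find-infix P (x ∷ xs) | inj₂ h with find-infix P xs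
... | inj₁ (pre , mid , post , refl , h′) = inj₁ (x ∷ pre , mid , post , refl , h′)
... | inj₂ h′ = inj₂ λ { [] mid post e → h mid post e ; (_ ∷ pre) mid post refl → h′ pre mid post refl }

module MedianOrder {V : Set} (r : V → V → Bool) where

  backward : List V → ℕ
  backward []       = 0
  backward (x ∷ xs) = count (λ y → r y x) xs + backward xs

  -- Only the pairs formed by `v` and an entry of `mid` change their order; the two added counts
  -- compensate for exactly these.
  backward-move : ∀ v mid post →
    backward (mid ++ v ∷ post) + count (λ y → r y v) mid ≡ backward (v ∷ mid ++ post) + count (r v) mid
  backward-move v []        post = refl
  backward-move v (m ∷ mid) post
    rewrite count-↭ (λ y → r y m) (shift v mid post) =
    ≡.trans (rearr₁ (toℕᵇ (r v m)) cm (backward (mid ++ v ∷ post)) (toℕᵇ (r m v)) _)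
      (≡.trans (cong (λ z → toℕᵇ (r v m) + cm + toℕᵇ (r m v) + z) (backward-move v mid post))
        (rearr₂ (toℕᵇ (r v m)) cm (toℕᵇ (r m v)) (count (λ y → r y v) (mid ++ post)) _ _))
    where
    cm : ℕ
    cm = count (λ y → r y m) (mid ++ post)
    rearr₁ : ∀ a c b d e → ((a + c) + b) + (d + e) ≡ a + c + d + (b + e)
    rearr₁ = solve-∀
    rearr₂ : ∀ a c d e f g → a + c + d + ((e + f) + g) ≡ ((d + e) + (c + f)) + (a + g)
    rearr₂ = solve-∀

  -- What a prefix entry contributes depends only on the multiset of entries after it, so the gain
  -- made behind the prefix survives.
  backward-context : ∀ pre {xs ys} → xs ↭ ys → backward xs < backward ys →
    backward (pre ++ xs) < backward (pre ++ ys)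
  backward-context []        p h = h
  backward-context (x ∷ pre) {xs} {ys} p h
    rewrite count-↭ (λ y → r y x) (++⁺ˡ pre p) =
    +-monoʳ-< (count (λ y → r y x) (pre ++ ys)) (backward-context pre p h)

  unbalancedFirst : List V → Bool
  unbalancedFirst []      = false
  unbalancedFirst (v ∷ m) = count (r v) m <ᵇ count (λ y → r y v) m

  unbalancedNext : List V → List V → Bool
  unbalancedNext mid []      = false
  unbalancedNext mid (v ∷ _) = count (λ y → r y v) mid <ᵇ count (r v) mid

  -- The vertex to be tested against a segment is its first entry or the entry following it.
  unbalanced : List V → List V → Bool
  unbalanced mid post = unbalancedFirst mid ∨ unbalancedNext mid post

  -- Stability under single moves: neither carrying the first entry past the rest of a segment nor
  -- carrying the entry after a segment to its front lowers `backward`.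
  LocalMedian : List V → Set
  LocalMedian o = ∀ pre mid post → o ≡ pre ++ mid ++ post → unbalanced mid post ≡ false

  shift-< : ∀ {a b c d} → a + c ≡ b + d → d < c → a < b
  shift-< {a} {b} {c} {d} e h = +-cancelʳ-< d a b (<-≤-trans (+-monoʳ-< a h) (≤-reflexive e))

  improve : ∀ pre mid post → unbalanced mid post ≡ true →
    ∃ λ o → pre ++ mid ++ post ↭ o × backward o < backward (pre ++ mid ++ post)
  improve pre []      []         ()
  improve pre []      (v ∷ post) ()
  improve pre (v ∷ m) post h with count (r v) m <ᵇ count (λ y → r y v) m in e
  ... | true = pre ++ m ++ v ∷ post , ++⁺ˡ pre (↭-sym (shift v m post)) ,
    backward-context pre (shift v m post) (shift-< (backward-move v m post) (true-<ᵇ e))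
  improve pre (w ∷ m) (v ∷ post) h | false = pre ++ v ∷ (w ∷ m) ++ post , ++⁺ˡ pre (shift v (w ∷ m) post) ,
    backward-context pre (↭-sym (shift v (w ∷ m) post))
      (shift-< (sym (backward-move v (w ∷ m) post)) (true-<ᵇ h))

  -- Every exchange lowers `backward`, so a bound `b` on it serves as fuel.
  local-median : ∀ b o → backward o ≤ b → ∃ λ o′ → o ↭ o′ × LocalMedian o′
  local-median b o h with find-infix unbalanced o
  ... | inj₂ good = o , ↭-refl , good
  ... | inj₁ (pre , mid , post , refl , bad) with improve pre mid post bad
  ...   | o₁ , p , lt with b | ≤-trans lt h
  ...     | suc b′ | s≤s h′ with local-median b′ o₁ h′
  ...       | o₂ , q , good = o₂ , ↭-trans p q , good

  module Positions (total : ∀ {u v} → u ≢ v → r u v ≡ true ⊎ r v u ≡ true)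
    (d : V) (o : List V) (unique : Unique o) (median : LocalMedian o) where

    arc : ℕ → ℕ → Bool
    arc i j = r (nth d o i) (nth d o j)

    both-ways : ∀ {v} mid → v ∉ mid → length mid ≤ count (r v) mid + count (λ y → r y v) mid
    both-ways []        _ = z≤n
    both-ways {v} (m ∷ mid) v∉ with both-ways mid (v∉ ∘ there) | total (λ e → v∉ (here e))
    ... | h | inj₁ e rewrite e = s≤s (≤-trans h (+-monoʳ-≤ (count (r v) mid) (m≤n+m _ _)))
    ... | h | inj₂ e rewrite e = ≤-trans (s≤s (≤-trans h (+-monoˡ-≤ _ (m≤n+m (count (r v) mid) (toℕᵇ (r v m))))))
      (≤-reflexive (sym (+-suc (toℕᵇ (r v m) + count (r v) mid) (count (λ y → r y v) mid))))

    majority : ∀ {ℓ m n} → ℓ ≤ m + n → n ≤ m → ℓ ≤ 2 * m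
    majority {ℓ} {m} {n} h h′ = ≤-trans h (≤-trans (+-monoʳ-≤ m h′)
      (≤-reflexive (cong (m +_) (sym (+-identityʳ m)))))

    ≮ᵇ : ∀ {m n} → (m <ᵇ n) ≡ false → n ≤ m
    ≮ᵇ {m} {n} e with m <? n
    ... | yes lt with m <ᵇ n | <ᵇ-true lt
    ≮ᵇ () | yes _ | true | _
    ≮ᵇ e | no  nlt = ≮⇒≥ nlt

    ∨-false : ∀ {a b} → a ∨ b ≡ false → a ≡ false × b ≡ false
    ∨-false {false} {false} _ = refl , refl

    out-median : ∀ v ℓ → suc v + ℓ ≤ length o → ℓ ≤ 2 * count (arc v) (range (suc v) ℓ)
    out-median v ℓ h with segment d o v (suc ℓ) (subst (_≤ length o) (sym (+-suc v ℓ)) h)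
    ... | pre , post , e = subst₂ (λ x y → x ≤ 2 * y)
      (≡.trans (length-map (nth d o) (range (suc v) ℓ)) (length-range (suc v) ℓ))
      (count-map (r (nth d o v)) (nth d o) (range (suc v) ℓ))
      (majority (both-ways mid x∉) (≮ᵇ {count (r (nth d o v)) mid} (proj₁ (∨-false {unbalancedFirst (nth d o v ∷ mid)} {unbalancedNext (nth d o v ∷ mid) post} (median pre (nth d o v ∷ mid) post e)))))
      where
      mid : List V
      mid = map (nth d o) (range (suc v) ℓ)
      x∉ : nth d o v ∉ mid
      x∉ x∈ with Unique-++ {xs = pre} (subst Unique e unique)
      ... | _ , (x≢ ∷ _) , _ = All.lookup x≢ (∈-++⁺ˡ x∈) refl

    in-median : ∀ a ℓ → a + ℓ < length o → ℓ ≤ 2 * count (λ x → arc x (a + ℓ)) (range a ℓ)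
    in-median a ℓ h with segment d o a (ℓ + 1) (subst (_≤ length o) (split a ℓ) h)
      where
      split : ∀ a ℓ → suc (a + ℓ) ≡ a + (ℓ + 1)
      split = solve-∀
    ... | pre , post , e = subst₂ (λ x y → x ≤ 2 * y)
      (≡.trans (length-map (nth d o) (range a ℓ)) (length-range a ℓ))
      (count-map (λ y → r y x) (nth d o) (range a ℓ))
      (majority {n = count (r x) mid} (subst (length mid ≤_) (+-comm (count (r x) mid) _) (both-ways mid x∉))
        (≮ᵇ {count (λ y → r y x) mid} (proj₂ (∨-false {unbalancedFirst mid} {unbalancedNext mid (x ∷ post)} (median pre mid (x ∷ post) e′)))))
      where
      x : V
      x = nth d o (a + ℓ)
      mid : List V
      mid = map (nth d o) (range a ℓ)
      e′ : o ≡ pre ++ mid ++ x ∷ post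
      e′ = ≡.trans e (cong (pre ++_) (≡.trans
        (cong (_++ post) (≡.trans (cong (map (nth d o)) (range-++ a ℓ 1)) (map-++ (nth d o) (range a ℓ) _)))
        (++-assoc mid (x ∷ []) post)))
      x∉ : x ∉ mid
      x∉ x∈ with Unique-++ {xs = pre} (subst Unique e′ unique)
      ... | _ , un , _ = proj₂ (proj₂ (Unique-++ {xs = mid} un)) x∈ (here refl)

-- Sets with dense common neighbourhoods inside one cell.

Unique-⊆ : ∀ {xs ys : List A} → xs ⊆ ys → Unique ys → Unique xs
Unique-⊆ []         _         = []
Unique-⊆ (_ ∷ʳ p)   (_ ∷ un)  = Unique-⊆ p un
Unique-⊆ (refl ∷ p) (x∉ ∷ un) = All.tabulate (λ x∈ → All.lookup x∉ (⊆-lookup p x∈)) ∷ Unique-⊆ p un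

all-∧ : ∀ (p q : A → Bool) X → all (λ x → p x ∧ q x) X ≡ true → all p X ≡ true × all q X ≡ true
all-∧ p q []      _ = refl , refl
all-∧ p q (x ∷ X) e with p x | q x
... | true | true = all-∧ p q X e

all-∈ : ∀ (p : A → Bool) {x} X → all p X ≡ true → x ∈ X → p x ≡ true
all-∈ p (x ∷ X) e (here refl) = proj₁ (∧-true e)
all-∈ p (x ∷ X) e (there x∈)  = all-∈ p X (proj₂ (∧-true {p x} e)) x∈

×-dense : ∀ p q x y X Y → p * x ≤ q * X → p * y ≤ q * Y → (p * p) * (x * y) ≤ (q * q) * (X * Y)
×-dense p q x y X Y h h′ =
  subst₂ _≤_ (sym (square p x y)) (sym (square q X Y)) (*-mono-≤ h h′)
  where
  square : ∀ c x y → (c * c) * (x * y) ≡ (c * x) * (c * y)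
  square = solve-∀

-- With `s = a k` the factor `k` cancels and leaves `a b P ≤ c P + c a G`. The surplus `e = a b - c`
-- of the average degree over the threshold then gives `e P ≤ c a G ≤ e f G`.
average : ∀ a b c e f {k s P G} → s ≡ a * k → a * b ≡ c + e → c * a ≤ e * f → 1 ≤ k → 1 ≤ e →
  s * (b * P) ≤ c * (k * P + s * G) → P ≤ f * G
average a b c e f {k} {s} {P} {G} refl ab≡ ca≤ 1≤k 1≤e h = *-cancelˡ-≤ e {{>-nonZero 1≤e}} (begin
  e * P           ≤⟨ +-cancelˡ-≤ (c * P) _ _ (*-cancelˡ-≤ k {{>-nonZero 1≤k}} scaled) ⟩
  (c * a) * G     ≤⟨ *-monoˡ-≤ G ca≤ ⟩
  (e * f) * G     ≡⟨ *-assoc e f G ⟩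
  e * (f * G)     ∎)
  where
  open ≤-Reasoning
  left : ∀ k a b P → k * ((a * b) * P) ≡ (a * k) * (b * P)
  left = solve-∀
  right : ∀ k a c P G → c * (k * P + (a * k) * G) ≡ k * (c * P + (c * a) * G)
  right = solve-∀
  scaled : k * (c * P + e * P) ≤ k * (c * P + (c * a) * G)
  scaled = begin
    k * (c * P + e * P)            ≡⟨ cong (k *_) (sym (*-distribʳ-+ P c e)) ⟩
    k * ((c + e) * P)              ≡⟨ cong (λ z → k * (z * P)) (sym ab≡) ⟩
    k * ((a * b) * P)              ≡⟨ left k a b P ⟩
    (a * k) * (b * P)              ≤⟨ h ⟩
    c * (k * P + (a * k) * G)      ≡⟨ right k a c P G ⟩
    k * (c * P + (c * a) * G)      ∎

-- Trimming to exactly `s` candidates fixes the loss `2 ^ s` of the halving.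
take-filter : ∀ (y : A → Bool) s C → s ≤ count y C →
  ∃ λ S → length S ≡ s × S ⊆ C × (∀ {x} → x ∈ S → y x ≡ true)
take-filter y s C s≤ = take s F ,
    ≡.trans (length-take s F) (m≤n⇒m⊓n≡m (≤-trans s≤ (≤-reflexive (sym (count-filterᵇ y C))))) ,
    ⊆-trans (take-⊆ s F) (filter-⊆ (T? ∘ y) C) ,
    λ x∈ → Equivalence.to T-≡ (proj₂ (∈-filter⁻ (T? ∘ y) {xs = C} (⊆-lookup (take-⊆ s F) x∈)))
  where
  F : List _
  F = filterᵇ y C

-- From here on the tournament is seen only through arcs between positions and the two median
-- inequalities.
module Selection
  (N : ℕ) (arc : ℕ → ℕ → Bool)
  (out-median : ∀ v ℓ → suc v + ℓ ≤ N → ℓ ≤ 2 * count (arc v) (range (suc v) ℓ))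
  (in-median : ∀ a ℓ → a + ℓ < N → ℓ ≤ 2 * count (λ x → arc x (a + ℓ)) (range a ℓ))
  (k s Q W : ℕ) (1≤k : 1 ≤ k) (1≤W : 1 ≤ W) (s≡ : s ≡ 8 * k) (Q≡ : Q ≡ 16 * 2 ^ s)
  where

  outsᵇ insᵇ : List ℕ → ℕ → Bool
  outsᵇ X z = all (λ x → arc x z) X
  insᵇ  X z = all (λ x → arc z x) X

  -- The median inequality starts right after `v`, whereas the window starts at the next cell
  -- boundary. The positions in between, at most `W`, are discounted; `8 ≤ m` makes this cost 1/16.
  out-dense : ∀ c m v → 8 ≤ m → (suc c + m) * W ≤ N → v ∈ range (c * W) W →
    7 * (m * W) ≤ 16 * count (arc v) (range (suc c * W) (m * W))
  in-dense : ∀ a m v → 8 ≤ m → suc (a + m) * W ≤ N → v ∈ range ((a + m) * W) W →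
    7 * (m * W) ≤ 16 * count (λ x → arc x v) (range (a * W) (m * W))

  private
    -- Here `r` and `c₁` belong to the rest of the own cell, `M` and `c₂` to the window:
    -- `M ≤ W + 2 c₂` and `W ≤ M / 8`.
    seven : ∀ r M c₁ c₂ → r + M ≤ 2 * (c₁ + c₂) → c₁ ≤ r → r ≤ W → 8 * W ≤ M → 7 * M ≤ 16 * c₂
    seven r M c₁ c₂ h c₁≤ r≤ W≤ = +-cancelˡ-≤ M _ _ (begin
      M + 7 * M            ≤⟨ *-monoʳ-≤ 8 M≤ ⟩
      8 * (W + 2 * c₂)     ≡⟨ *-distribˡ-+ 8 W (2 * c₂) ⟩
      8 * W + 8 * (2 * c₂) ≤⟨ +-mono-≤ W≤ (≤-reflexive (sym (*-assoc 8 2 c₂))) ⟩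
      M + 16 * c₂          ∎)
      where
      open ≤-Reasoning
      assoc₂ : ∀ r c₂ → 2 * (r + c₂) ≡ r + (r + 2 * c₂)
      assoc₂ = solve-∀
      M≤ : M ≤ W + 2 * c₂
      M≤ = ≤-trans (+-cancelˡ-≤ r _ _ (≤-trans h (≤-trans (*-monoʳ-≤ 2 (+-monoˡ-≤ c₂ c₁≤))
        (≤-reflexive (assoc₂ r c₂))))) (+-monoˡ-≤ (2 * c₂) r≤)

  out-dense c m v 8≤m ≤N v∈ with ∈-range⁻ (c * W) W v∈
  ... | cW≤ , v< with m≤n⇒∃[o]m+o≡n v<
  ... | r , e = seven r (m * W) _ _
      (subst (r + m * W ≤_) (cong (2 *_) split) (out-median v (r + m * W) (≤-trans (≤-reflexive total) ≤N)))
      (subst (count (arc v) (range (suc v) r) ≤_) (length-range (suc v) r) (count≤length (arc v) (range (suc v) r)))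
      r≤ (*-monoˡ-≤ W 8≤m)
    where
    end : suc v + r ≡ suc c * W
    end = ≡.trans e (+-comm (c * W) W)
    split : count (arc v) (range (suc v) (r + m * W)) ≡
      count (arc v) (range (suc v) r) + count (arc v) (range (suc c * W) (m * W))
    split = ≡.trans (cong (count (arc v)) (range-++ (suc v) r (m * W)))
      (≡.trans (count-++ (arc v) (range (suc v) r) _)
        (cong (λ z → count (arc v) (range (suc v) r) + count (arc v) (range z (m * W))) end))
    total : suc v + (r + m * W) ≡ (suc c + m) * W
    total = ≡.trans (sym (+-assoc (suc v) r (m * W)))
      (≡.trans (cong (_+ m * W) end) (sym (*-distribʳ-+ W (suc c) m)))
    r≤ : r ≤ W
    r≤ = +-cancelˡ-≤ (c * W) _ _ (≤-trans (+-monoˡ-≤ r (m≤n⇒m≤1+n cW≤)) (≤-reflexive e))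

  in-dense a m v 8≤m ≤N v∈ with ∈-range⁻ ((a + m) * W) W v∈
  ... | cW≤ , v< with m≤n⇒∃[o]m+o≡n cW≤
  ... | r , e = seven r (m * W) _ _
      (subst (λ z → r + m * W ≤ 2 * z) split (≤-trans (≤-reflexive (+-comm r (m * W)))
        (in-median (a * W) (m * W + r) (≤-trans (s≤s (≤-reflexive end)) (≤-trans v< (≤-trans (≤-reflexive (+-comm _ W)) ≤N))))))
      (subst (count (λ x → arc x v) (range (a * W + m * W) r) ≤_) (length-range _ r) (count≤length _ (range (a * W + m * W) r)))
      r≤ (*-monoˡ-≤ W 8≤m)
    where
    end : a * W + (m * W + r) ≡ v
    end = ≡.trans (≡.trans (sym (+-assoc (a * W) (m * W) r)) (cong (_+ r) (sym (*-distribʳ-+ W a m)))) e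
    split : count (λ x → arc x (a * W + (m * W + r))) (range (a * W) (m * W + r)) ≡
      count (λ x → arc x v) (range (a * W + m * W) r) + count (λ x → arc x v) (range (a * W) (m * W))
    split rewrite end = ≡.trans (cong (count (λ x → arc x v)) (range-++ (a * W) (m * W) r))
      (≡.trans (count-++ (λ x → arc x v) (range (a * W) (m * W)) _) (+-comm (count (λ x → arc x v) (range (a * W) (m * W))) _))
    r≤ : r ≤ W
    r≤ = +-cancelˡ-≤ ((a + m) * W) _ _ (≤-trans (≤-reflexive e) (<⇒≤ v<))

  pairArc : ℕ → ℕ × ℕ → Bool
  pairArc v z = arc (proj₁ z) v ∧ arc v (proj₂ z)

  -- The common pairs lie in the product of the two common neighbourhoods. Bounding one factor by
  -- its whole window forces density `1 / Q` on the other.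
  pairs-dense : ∀ X I O G → 1 ≤ length I → 1 ≤ length O → length I * length O ≤ 16 * G →
    G ≤ 2 ^ s * count (commonᵇ pairArc X) (cartesianProduct I O) →
    length O ≤ Q * count (outsᵇ X) O × length I ≤ Q * count (insᵇ X) I
  pairs-dense X I O G 1≤I 1≤O IO≤ G≤ =
    *-cancelˡ-≤ (length I) {{>-nonZero 1≤I}} (≤-trans P≤
      (≤-trans (*-monoʳ-≤ Q (*-monoˡ-≤ cO (count≤length (insᵇ X) I))) (≤-reflexive (eq₁ Q (length I) cO)))) ,
    *-cancelˡ-≤ (length O) {{>-nonZero 1≤O}} (≤-trans (≤-reflexive (*-comm (length O) (length I))) (≤-trans P≤
      (≤-trans (*-monoʳ-≤ Q (*-monoʳ-≤ cI (count≤length (outsᵇ X) O))) (≤-reflexive (eq₂ Q cI (length O))))))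
    where
    cI cO : ℕ
    cI = count (insᵇ X) I
    cO = count (outsᵇ X) O
    both : ∀ {z} → z ∈ cartesianProduct I O → commonᵇ pairArc X z ≡ true →
      insᵇ X (proj₁ z) ∧ outsᵇ X (proj₂ z) ≡ true
    both {z} _ e with all-∧ (arc (proj₁ z)) (λ v → arc v (proj₂ z)) X e
    ... | e₁ , e₂ = cong₂ _∧_ e₁ e₂
    G≤′ : G ≤ 2 ^ s * (cI * cO)
    G≤′ = ≤-trans G≤ (*-monoʳ-≤ (2 ^ s) (≤-trans (count-mono (cartesianProduct I O) both)
      (≤-reflexive (count-× (insᵇ X) (outsᵇ X) I O))))
    P≤ : length I * length O ≤ Q * (cI * cO)
    P≤ = ≤-trans IO≤ (≤-trans (*-monoʳ-≤ 16 G≤′)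
      (≤-reflexive (≡.trans (sym (*-assoc 16 (2 ^ s) (cI * cO))) (cong (_* (cI * cO)) (sym Q≡)))))
    eq₁ : ∀ Q M c → Q * (M * c) ≡ M * (Q * c)
    eq₁ = solve-∀
    eq₂ : ∀ Q c M → Q * (c * M) ≡ M * (Q * c)
    eq₂ = solve-∀

  -- A vertex of S is adjacent to 49/256 of the pairs, which exceeds k/s = 1/8 by more than 1/16.
  many-good : ∀ S I O → length S ≡ s →
    (∀ {v} → v ∈ S → 7 * length I ≤ 16 * count (λ x → arc x v) I × 7 * length O ≤ 16 * count (arc v) O) →
    length I * length O ≤ 16 * count (λ z → k ≤ᵇ degree pairArc S z) (cartesianProduct I O)
  many-good S I O lenS dense =
    -- `8 * 49 = 256 + 136` and `256 * 8 ≤ 136 * 16`.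
    average 8 (7 * 7) (16 * 16) 136 16 {P = length I * length O} {G = G} s≡ refl (≤ᵇ⇒≤ _ _ _) 1≤k (s≤s z≤n)
      (subst₂ (λ l p → l * ((7 * 7) * (length I * length O)) ≤ (16 * 16) * (k * p + l * G))
        {length S} {s} {length zs} {length I * length O} lenS length-zs
        (≤-trans (sum-lower (λ v → count (pairArc v) zs) ((7 * 7) * (length I * length O)) (16 * 16) S many)
          (*-monoʳ-≤ (16 * 16) (sum-counts≤ pairArc S k zs))))
    where
    zs : List (ℕ × ℕ)
    zs = cartesianProduct I O
    G : ℕ
    G = count (λ z → k ≤ᵇ degree pairArc S z) zs
    length-zs : length zs ≡ length I * length O
    length-zs = ≡.trans (sym (count-all {p = λ _ → true ∧ true} zs (λ _ → refl)))
      (≡.trans (count-× (λ _ → true) (λ _ → true) I O)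
        (cong₂ _*_ (count-all I (λ _ → refl)) (count-all O (λ _ → refl))))
    many : ∀ {v} → v ∈ S → (7 * 7) * (length I * length O) ≤ (16 * 16) * count (pairArc v) zs
    many {v} v∈ = subst (λ z → (7 * 7) * (length I * length O) ≤ (16 * 16) * z)
      (sym (count-× (λ x → arc x v) (arc v) I O))
      (×-dense 7 16 (length I) (length O) (count (λ x → arc x v) I) (count (arc v) O)
        (proj₁ (dense v∈)) (proj₂ (dense v∈)))

  1≤16* : ∀ g → 1 ≤ 16 * g → 1 ≤ g
  1≤16* zero    ()
  1≤16* (suc g) _ = s≤s z≤n

  select-from : ∀ (y : ℕ → Bool) C I O → 1 ≤ length I → 1 ≤ length O → s ≤ count y C →
    (∀ {v} → v ∈ C → 7 * length I ≤ 16 * count (λ x → arc x v) I × 7 * length O ≤ 16 * count (arc v) O) →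
    ∃ λ X → length X ≡ k × X ⊆ C × (∀ {x} → x ∈ X → y x ≡ true) ×
      length O ≤ Q * count (outsᵇ X) O × length I ≤ Q * count (insᵇ X) I
  select-from y C I O 1≤I 1≤O s≤ dense = fromS (take-filter y s C s≤)
    where
    zs : List (ℕ × ℕ)
    zs = cartesianProduct I O
    Goal : Set
    Goal = ∃ λ X → length X ≡ k × X ⊆ C × (∀ {x} → x ∈ X → y x ≡ true) ×
      length O ≤ Q * count (outsᵇ X) O × length I ≤ Q * count (insᵇ X) I
    good : List ℕ → ℕ
    good S = count (λ z → k ≤ᵇ degree pairArc S z) zs
    fromX : ∀ S → length S ≡ s → S ⊆ C → (∀ {x} → x ∈ S → y x ≡ true) → length I * length O ≤ 16 * good S →
      (∃ λ X → X ⊆ S × length X ≡ k × good S ≤ 2 ^ length S * count (commonᵇ pairArc X) zs) → Goal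
    fromX S lenS S⊆C yS P≤ (X , X⊆S , lenX , G≤) =
      X , lenX , ⊆-trans X⊆S S⊆C , (λ x∈ → yS (⊆-lookup X⊆S x∈)) ,
      pairs-dense X I O (good S) 1≤I 1≤O P≤
        (subst (λ l → good S ≤ 2 ^ l * count (commonᵇ pairArc X) zs) lenS G≤)
    fromS : (∃ λ S → length S ≡ s × S ⊆ C × (∀ {x} → x ∈ S → y x ≡ true)) → Goal
    fromS (S , lenS , S⊆C , yS) = fromX S lenS S⊆C yS P≤
      (select-common pairArc zs k S (λ _ → true) (1≤16* (good S) (≤-trans (*-mono-≤ 1≤I 1≤O) P≤)))
      where
      P≤ : length I * length O ≤ 16 * good S
      P≤ = many-good S I O lenS (λ v∈ → dense (⊆-lookup S⊆C v∈))

  -- All candidates lie in the cell `a + m₁`, so the `m₁` cells before it and the `m₂` cells after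
  -- it serve as windows for every one of them.
  select-dense : ∀ (y : ℕ → Bool) a m₁ m₂ → 8 ≤ m₁ → 8 ≤ m₂ → (suc (a + m₁) + m₂) * W ≤ N →
    s ≤ count y (range ((a + m₁) * W) W) →
    ∃ λ X → length X ≡ k × X ⊆ range ((a + m₁) * W) W × (∀ {x} → x ∈ X → y x ≡ true) ×
      m₂ * W ≤ Q * count (outsᵇ X) (range (suc (a + m₁) * W) (m₂ * W)) ×
      m₁ * W ≤ Q * count (insᵇ X) (range (a * W) (m₁ * W))
  select-dense y a m₁ m₂ 8≤m₁ 8≤m₂ ≤N s≤ =
    subst₂ (λ lI lO → ∃ λ X → length X ≡ k × X ⊆ range ((a + m₁) * W) W × (∀ {x} → x ∈ X → y x ≡ true) ×
        lO ≤ Q * count (outsᵇ X) O × lI ≤ Q * count (insᵇ X) I) lenI lenO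
      (select-from y (range ((a + m₁) * W) W) I O
        (≤-trans (*-mono-≤ (≤-trans (s≤s z≤n) 8≤m₁) 1≤W) (≤-reflexive (sym lenI)))
        (≤-trans (*-mono-≤ (≤-trans (s≤s z≤n) 8≤m₂) 1≤W) (≤-reflexive (sym lenO))) s≤
        (λ {v} v∈ →
          subst (λ l → 7 * l ≤ 16 * count (λ x → arc x v) I) (sym lenI)
            (in-dense a m₁ v 8≤m₁ (≤-trans (*-monoˡ-≤ W (m≤m+n (suc (a + m₁)) m₂)) ≤N) v∈) ,
          subst (λ l → 7 * l ≤ 16 * count (arc v) O) (sym lenO)
            (out-dense (a + m₁) m₂ v 8≤m₂ ≤N v∈)))
    where
    I O : List ℕ
    I = range (a * W) (m₁ * W)
    O = range (suc (a + m₁) * W) (m₂ * W)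
    lenI : length I ≡ m₁ * W
    lenI = length-range (a * W) (m₁ * W)
    lenO : length O ≡ m₂ * W
    lenO = length-range (suc (a + m₁) * W) (m₂ * W)

-- Rooted forests and truncated budgets.

-- A rooted tree is given by the forest below its root, in first-child/next-sibling
-- form; the boolean tells whether the arc to the child leaves its parent.
data Forest : Set where
  leaf : Forest
  node : Bool → Forest → Forest → Forest

degᶠ : Forest → ℕ
degᶠ leaf         = 0
degᶠ (node _ _ r) = suc (degᶠ r)

-- The number of vertices of the forest that are not roots.
inner : Forest → ℕ
inner leaf         = 0
inner (node _ c r) = (degᶠ c + inner c) + inner r

data Pos : Forest → Set where
  here : ∀ {b c r} → Pos (node b c r)
  down : ∀ {b c r} → Pos c → Pos (node b c r)
  next : ∀ {b c r} → Pos r → Pos (node b c r)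

data Top : ∀ {f} → Bool → Pos f → Set where
  here : ∀ {b c r} → Top b (here {b} {c} {r})
  next : ∀ {d b c r} {q : Pos r} → Top d q → Top d (next {b} {c} {r} q)

data Below : ∀ {f} → Bool → Pos f → Pos f → Set where
  here : ∀ {d b c r} {q : Pos c} → Top d q → Below d (here {b} {c} {r}) (down q)
  down : ∀ {d b c r} {p q : Pos c} → Below d p q → Below d (down {b} {c} {r} p) (down q)
  next : ∀ {d b c r} {p q : Pos r} → Below d p q → Below d (next {b} {c} {r} p) (next q)

leaf? : ∀ f → 1 ≤ degᶠ f ⊎ f ≡ leaf
leaf? leaf         = inj₂ refl
leaf? (node _ _ _) = inj₁ (s≤s z≤n)

-- The budget of a suffix starting at `x` grows by at least `g` when the boundary `b` moves by
-- `2 g`: even for `x` past `b`, where the old budget is 0, the last `g` cells lie beyond `x`.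
∸-grow : ∀ b g x → x ≤ b + g → (b ∸ x) + g ≤ (b + (g + g)) ∸ x
∸-grow b g x h = m+n≤o⇒m≤o∸n _ (go (≤-total x b))
  where
  go : x ≤ b ⊎ b ≤ x → (b ∸ x) + g + x ≤ b + (g + g)
  go (inj₁ x≤b) = ≤-trans (≤-reflexive (≡.trans (swap₃ (b ∸ x) g x) (cong (_+ g) (m∸n+n≡m x≤b))))
    (+-monoʳ-≤ b (m≤m+n g g))
    where
    swap₃ : ∀ a g x → a + g + x ≡ (a + x) + g
    swap₃ = solve-∀
  go (inj₂ b≤x) rewrite m≤n⇒m∸n≡0 b≤x = ≤-trans (+-monoʳ-≤ g h) (≤-reflexive (swap₃ g b))
    where
    swap₃ : ∀ g b → g + (b + g) ≡ b + (g + g)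
    swap₃ = solve-∀

∸-shrink : ∀ a g x → a + g ≤ x → (x ∸ (a + (g + g))) + g ≤ x ∸ a
∸-shrink a g x h = m+n≤o⇒m≤o∸n _ (go (≤-total (a + (g + g)) x))
  where
  go : a + (g + g) ≤ x ⊎ x ≤ a + (g + g) → (x ∸ (a + (g + g))) + g + a ≤ x
  go (inj₁ le) = ≤-trans (≤-reflexive (+-assoc (x ∸ (a + (g + g))) g a))
    (≤-trans (+-monoʳ-≤ (x ∸ (a + (g + g))) (≤-trans (≤-reflexive (+-comm g a)) (+-monoʳ-≤ a (m≤m+n g g))))
      (≤-reflexive (m∸n+n≡m le)))
  go (inj₂ le) rewrite m≤n⇒m∸n≡0 le = ≤-trans (≤-reflexive (+-comm g a)) h

-- Embedding the blow-up of a rooted forest into the order.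

module Embedding
  (N : ℕ) (arc : ℕ → ℕ → Bool)
  (out-median : ∀ v ℓ → suc v + ℓ ≤ N → ℓ ≤ 2 * count (arc v) (range (suc v) ℓ))
  (in-median : ∀ a ℓ → a + ℓ < N → ℓ ≤ 2 * count (λ x → arc x (a + ℓ)) (range a ℓ))
  (k s Q W h n : ℕ) (1≤k : 1 ≤ k) (s≡ : s ≡ 8 * k) (Q≡ : Q ≡ 16 * 2 ^ s) (W≡ : W ≡ (2 * Q) * s)
  (8≤h : 8 ≤ h) (N≥ : ((h + h) * (n + n)) * W ≤ N)
  where

  k≤s : k ≤ s
  k≤s = subst (k ≤_) (sym s≡) (m≤m+n k _)

  1≤2Q : 1 ≤ 2 * Q
  1≤2Q = subst (λ q → 1 ≤ 2 * q) (sym Q≡) (*-mono-≤ {1} {2} (s≤s z≤n) (*-mono-≤ {1} {16} (s≤s z≤n) (m^n>0 2 s)))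

  s≤W : s ≤ W
  s≤W = ≤-trans (≤-reflexive (sym (*-identityˡ s))) (≤-trans (*-monoˡ-≤ s 1≤2Q) (≤-reflexive (sym W≡)))

  1≤W : 1 ≤ W
  1≤W = ≤-trans 1≤k (≤-trans k≤s s≤W)

  1≤h : 1 ≤ h
  1≤h = ≤-trans (s≤s z≤n) 8≤h

  open Selection N arc out-median in-median k s Q W 1≤k 1≤W s≡ Q≡

  -- The interval of cells in use once t sets are placed.
  lower upper : ℕ → ℕ
  lower t = (h + h) * (n ∸ t)
  upper t = (h + h) * (n + t)

  -- When the next d sets are placed together, they go only half of the way to
  -- the new boundaries, which keeps the outermost cells sparsely used.
  lower′ upper′ : ℕ → ℕ → ℕ
  lower′ t d = lower (t + d) + h * d
  upper′ t d = upper t + h * d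

  upper-+ : ∀ t d → upper (t + d) ≡ upper t + (h * d + h * d)
  upper-+ t d = eq h n t d
    where
    eq : ∀ h n t d → (h + h) * (n + (t + d)) ≡ (h + h) * (n + t) + (h * d + h * d)
    eq = solve-∀

  lower-+ : ∀ t d → t + d ≤ n → lower t ≡ lower (t + d) + (h * d + h * d)
  lower-+ t d le with m≤n⇒∃[o]m+o≡n le
  ... | o , refl = ≡.trans (cong ((h + h) *_) (≡.trans (cong (_∸ t) (+-assoc t d o)) (m+n∸m≡n t (d + o))))
      (≡.trans (eq h d o) (cong (λ z → (h + h) * z + (h * d + h * d)) (sym (m+n∸m≡n (t + d) o))))
    where
    eq : ∀ h d o → (h + h) * (d + o) ≡ (h + h) * o + (h * d + h * d)
    eq = solve-∀

  upper-mono : ∀ {t t′} → t ≤ t′ → upper t ≤ upper t′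
  upper-mono le = *-monoʳ-≤ (h + h) (+-monoʳ-≤ n le)

  lower-anti : ∀ {t t′} → t ≤ t′ → lower t′ ≤ lower t
  lower-anti le = *-monoʳ-≤ (h + h) (∸-monoʳ-≤ n le)

  upper′≤ : ∀ t d → upper′ t d ≤ upper (t + d)
  upper′≤ t d = ≤-trans (+-monoʳ-≤ (upper t) (m≤m+n (h * d) (h * d))) (≤-reflexive (sym (upper-+ t d)))

  lower′≤ : ∀ t d → t + d ≤ n → lower′ t d ≤ lower t
  lower′≤ t d le = ≤-trans (+-monoʳ-≤ (lower (t + d)) (m≤m+n (h * d) (h * d))) (≤-reflexive (sym (lower-+ t d le)))

  upper′-N : ∀ t d → t + d ≤ n → upper′ t d * W ≤ N
  upper′-N t d le = ≤-trans (*-monoˡ-≤ W (≤-trans (upper′≤ t d) (upper-mono le))) N≥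

  Joined : Bool → List ℕ → List ℕ → Set
  Joined true  X Y = ∀ {x y} → x ∈ X → y ∈ Y → arc x y ≡ true
  Joined false X Y = ∀ {x y} → x ∈ X → y ∈ Y → arc y x ≡ true

  -- X has dense common neighbourhoods at the scale at which its d children
  -- will be placed, namely at time t.
  record Ready (t d : ℕ) (X : List ℕ) : Set where
    field
      cell   : ℕ
      lower≤ : lower t ≤ cell
      <upper : cell < upper t
      mᵢ mₒ  : ℕ
      mᵢ≡    : lower′ t d + mᵢ ≡ cell
      mₒ≡    : suc cell + mₒ ≡ upper′ t d
      inside : ∀ {x} → x ∈ X → x ∈ range (cell * W) W
      outs≥  : mₒ * W ≤ Q * count (outsᵇ X) (range (suc cell * W) (mₒ * W))
      ins≥   : mᵢ * W ≤ Q * count (insᵇ X) (range (lower′ t d * W) (mᵢ * W))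

  -- Used positions have density at most `1 / (2 Q)` in every suffix and prefix of the region. By
  -- truncation the same inequalities say that nothing used lies outside it.
  record State (t : ℕ) (U : List ℕ) : Set where
    field
      right   : ∀ x → (2 * Q) * count (x * W ≤ᵇ_) U ≤ (upper t ∸ x) * W
      left    : ∀ x → (2 * Q) * count (_<ᵇ x * W) U ≤ (x ∸ lower t) * W
      unique  : Unique U
      bounded : ∀ {u} → u ∈ U → u < N

  Within : ℕ → ℕ → List ℕ → Set
  Within t d Y = ∀ {y} → y ∈ Y → lower′ t d * W ≤ y × y < upper′ t d * W

  -- A cell within the half-way boundaries of one stage is at least `h` cells away from the
  -- boundaries of every later stage. Both windows at the future time `t′` thus have the 8 cells
  -- that `select-dense` asks for.
  settle : ∀ t d → 1 ≤ d → t + d ≤ n → ∀ c → lower′ t d ≤ c → c < upper′ t d →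
    ∀ (y : ℕ → Bool) → s ≤ count y (range (c * W) W) → ∀ t′ d′ → t + d ≤ t′ → t′ + d′ ≤ n →
    ∃ λ Y → length Y ≡ k × Unique Y × (∀ {z} → z ∈ Y → z ∈ range (c * W) W × y z ≡ true) ×
      Within t d Y × Ready t′ d′ Y
  settle t d 1≤d le c l≤c c<u y s≤ t′ d′ le′ le″ = build (m≤n⇒∃[o]m+o≡n l′≤c) (m≤n⇒∃[o]m+o≡n c<u′)
    where
    h≤hd : h ≤ h * d
    h≤hd = ≤-trans (≤-reflexive (sym (*-identityʳ h))) (*-monoʳ-≤ h 1≤d)
    low : lower t′ + h ≤ c
    low = ≤-trans (+-mono-≤ (lower-anti le′) h≤hd) l≤c
    up : suc c + h ≤ upper t′
    up = ≤-trans (+-mono-≤ c<u h≤hd) (≤-trans (≤-reflexive (+-assoc (upper t) (h * d) (h * d)))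
      (≤-trans (≤-reflexive (sym (upper-+ t d))) (upper-mono le′)))
    low′ : lower′ t′ d′ + h ≤ c
    low′ = ≤-trans (+-monoˡ-≤ h (lower′≤ t′ d′ le″)) low
    up′ : suc c + h ≤ upper′ t′ d′
    up′ = ≤-trans up (m≤m+n (upper t′) (h * d′))
    l′≤c : lower′ t′ d′ ≤ c
    l′≤c = m+n≤o⇒m≤o (lower′ t′ d′) low′
    c<u′ : suc c ≤ upper′ t′ d′
    c<u′ = m+n≤o⇒m≤o (suc c) up′
    build : (∃ λ m → lower′ t′ d′ + m ≡ c) → (∃ λ m → suc c + m ≡ upper′ t′ d′) → _
    build (m₁ , refl) (m₂ , e₂) = finish
        (select-dense y (lower′ t′ d′) m₁ m₂
          (≤-trans 8≤h (+-cancelˡ-≤ (lower′ t′ d′) _ _ low′))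
          (≤-trans 8≤h (+-cancelˡ-≤ (suc c) _ _ (≤-trans up′ (≤-reflexive (sym e₂)))))
          (≤-trans (≤-reflexive (cong (_* W) e₂)) (upper′-N t′ d′ le″)) s≤)
      where
      finish : (∃ λ X → length X ≡ k × X ⊆ range (c * W) W × (∀ {x} → x ∈ X → y x ≡ true) ×
          m₂ * W ≤ Q * count (outsᵇ X) (range (suc c * W) (m₂ * W)) ×
          m₁ * W ≤ Q * count (insᵇ X) (range (lower′ t′ d′ * W) (m₁ * W))) →
        ∃ λ Y → length Y ≡ k × Unique Y × (∀ {z} → z ∈ Y → z ∈ range (c * W) W × y z ≡ true) ×
          Within t d Y × Ready t′ d′ Y
      finish (X , lenX , X⊆ , yX , outs , ins) =
        X , lenX , Unique-⊆ X⊆ (range-unique (c * W) W) , (λ x∈ → ⊆-lookup X⊆ x∈ , yX x∈) ,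
        (λ x∈ → let (a , b) = ∈-range⁻ (c * W) W (⊆-lookup X⊆ x∈) in
          ≤-trans (*-monoˡ-≤ W l≤c) a ,
          <-≤-trans b (≤-trans (≤-reflexive (+-comm (c * W) W)) (*-monoˡ-≤ W c<u))) ,
        record
          { cell = c ; lower≤ = m+n≤o⇒m≤o (lower t′) low ; <upper = m+n≤o⇒m≤o (suc c) up
          ; mᵢ = m₁ ; mₒ = m₂ ; mᵢ≡ = refl ; mₒ≡ = e₂
          ; inside = ⊆-lookup X⊆ ; outs≥ = outs ; ins≥ = ins }

  -- Density `1 / Q` minus density `1 / (2 Q)` leaves `m W / (2 Q)`, which is `m s` by the choice of
  -- `W`.
  free-count : ∀ (p q : ℕ → Bool) xs V m → Unique xs → (∀ {x} → x ∈ xs → q x ≡ true) →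
    m * W ≤ Q * count p xs → (2 * Q) * count q V ≤ m * W →
    m * s ≤ count (λ x → p x ∧ notElem x V) xs
  free-count p q xs V m un qxs h₁ h₂ = *-cancelˡ-≤ (2 * Q) {{>-nonZero 1≤2Q}}
      (≤-trans (≤-reflexive (≡.trans (shuffle (2 * Q) m s) (cong (m *_) (sym W≡))))
        (+-cancelʳ-≤ (m * W) _ _ (begin
          m * W + m * W                                        ≡⟨ double (m * W) ⟩
          2 * (m * W)                                          ≤⟨ *-monoʳ-≤ 2 h₁ ⟩
          2 * (Q * count p xs)                                 ≡⟨ sym (*-assoc 2 Q (count p xs)) ⟩
          (2 * Q) * count p xs                                 ≤⟨ *-monoʳ-≤ (2 * Q) (count-avoid p q xs V un qxs) ⟩
          (2 * Q) * (cf + count q V)                           ≡⟨ *-distribˡ-+ (2 * Q) cf (count q V) ⟩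
          (2 * Q) * cf + (2 * Q) * count q V                   ≤⟨ +-monoʳ-≤ ((2 * Q) * cf) h₂ ⟩
          (2 * Q) * cf + m * W                                 ∎)))
    where
    open ≤-Reasoning
    cf : ℕ
    cf = count (λ x → p x ∧ notElem x V) xs
    shuffle : ∀ q m s → q * (m * s) ≡ m * (q * s)
    shuffle = solve-∀
    double : ∀ x → x + x ≡ 2 * x
    double = solve-∀

  outsᵇ-Joined : ∀ {X Y} → (∀ {y} → y ∈ Y → outsᵇ X y ≡ true) → Joined true X Y
  outsᵇ-Joined {X} f {x} {y} x∈ y∈ = all-∈ (λ x → arc x y) X (f y∈) x∈

  insᵇ-Joined : ∀ {X Y} → (∀ {y} → y ∈ Y → insᵇ X y ≡ true) → Joined false X Y
  insᵇ-Joined {X} f {x} {y} x∈ y∈ = all-∈ (λ x → arc y x) X (f y∈) x∈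

  Child : Bool → List ℕ → ℕ → ℕ → List ℕ → ℕ → ℕ → Set
  Child b X t d V t′ d′ = ∃ λ Y → length Y ≡ k × Unique Y × (∀ {y} → y ∈ Y → y ∉ V) ×
    Joined b X Y × Within t d Y × Ready t′ d′ Y

  module _ {t d X} (ready : Ready t d X) (1≤d : 1 ≤ d) (le : t + d ≤ n) where
    open Ready ready

    place-child : ∀ b V → (2 * Q) * count (suc cell * W ≤ᵇ_) V ≤ mₒ * W →
      (2 * Q) * count (_<ᵇ cell * W) V ≤ mᵢ * W → ∀ t′ d′ → t + d ≤ t′ → t′ + d′ ≤ n →
      Child b X t d V t′ d′
    place-child true V r≤ _ t′ d′ le′ le″ = finish (pigeonhole free W s mₒ (suc cell)
        (free-count (outsᵇ X) (suc cell * W ≤ᵇ_) xs V mₒ (range-unique _ (mₒ * W))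
          (λ x∈ → ≤ᵇ-true (proj₁ (∈-range⁻ (suc cell * W) (mₒ * W) x∈))) outs≥ r≤)
        -- The half step `h * d` keeps the window nonempty even when `cell` is the last cell in use.
        (+-cancelˡ-≤ (suc cell) _ _ (≤-trans (+-mono-≤ <upper (*-mono-≤ 1≤h 1≤d)) (≤-reflexive (sym mₒ≡)))))
      where
      xs : List ℕ
      xs = range (suc cell * W) (mₒ * W)
      free : ℕ → Bool
      free y = outsᵇ X y ∧ notElem y V
      finish : (∃ λ j → j < mₒ × s ≤ count free (range ((suc cell + j) * W) W)) → Child true X t d V t′ d′
      finish (j , j< , s≤) with settle t d 1≤d le (suc cell + j)
        (≤-trans (lower′≤ t d le) (≤-trans lower≤ (≤-trans (n≤1+n cell) (m≤m+n (suc cell) j))))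
        (<-≤-trans (+-monoʳ-< (suc cell) j<) (≤-reflexive mₒ≡)) free s≤ t′ d′ le′ le″
      ... | Y , lenY , unY , inY , within , rdy = Y , lenY , unY ,
        (λ y∈ → notElem-∉ V (proj₂ (∧-true {outsᵇ X _} (proj₂ (inY y∈))))) ,
        outsᵇ-Joined (λ y∈ → proj₁ (∧-true (proj₂ (inY y∈)))) , within , rdy
    place-child false V _ l≤ t′ d′ le′ le″ = finish (pigeonhole free W s mᵢ (lower′ t d)
        (free-count (insᵇ X) (_<ᵇ cell * W) xs V mᵢ (range-unique _ (mᵢ * W))
          (λ x∈ → <ᵇ-true (<-≤-trans (proj₂ (∈-range⁻ (lower′ t d * W) (mᵢ * W) x∈))
            (≤-reflexive (≡.trans (sym (*-distribʳ-+ W (lower′ t d) mᵢ)) (cong (_* W) mᵢ≡))))) ins≥ l≤)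
        (+-cancelˡ-≤ (lower′ t d) _ _ (≤-trans (+-monoʳ-≤ (lower′ t d) (*-mono-≤ 1≤h 1≤d))
          (≤-trans (≤-reflexive (≡.trans (+-assoc (lower (t + d)) (h * d) (h * d)) (sym (lower-+ t d le))))
            (≤-trans lower≤ (≤-reflexive (sym mᵢ≡)))))))
      where
      xs : List ℕ
      xs = range (lower′ t d * W) (mᵢ * W)
      free : ℕ → Bool
      free y = insᵇ X y ∧ notElem y V
      finish : (∃ λ j → j < mᵢ × s ≤ count free (range ((lower′ t d + j) * W) W)) → Child false X t d V t′ d′
      finish (j , j< , s≤) with settle t d 1≤d le (lower′ t d + j)
        (m≤m+n (lower′ t d) j)
        (<-trans (<-≤-trans (+-monoʳ-< (lower′ t d) j<) (≤-reflexive mᵢ≡))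
          (<-≤-trans <upper (m≤m+n (upper t) (h * d)))) free s≤ t′ d′ le′ le″
      ... | Y , lenY , unY , inY , within , rdy = Y , lenY , unY ,
        (λ y∈ → notElem-∉ V (proj₂ (∧-true {insᵇ X _} (proj₂ (inY y∈))))) ,
        insᵇ-Joined (λ y∈ → proj₁ (∧-true (proj₂ (inY y∈)))) , within , rdy

  -- As `k ≤ s` and `W = 2 Q s`, a new `k`-set uses up the budget of at most one cell, and `h` cells
  -- are granted to each.
  2Qkd≤ : ∀ d → (2 * Q) * (d * k) ≤ (h * d) * W
  2Qkd≤ d = begin
    (2 * Q) * (d * k)  ≡⟨ shuffle (2 * Q) d k ⟩
    d * ((2 * Q) * k)  ≤⟨ *-monoʳ-≤ d (*-monoʳ-≤ (2 * Q) k≤s) ⟩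
    d * ((2 * Q) * s)  ≡⟨ cong (d *_) (sym W≡) ⟩
    d * W              ≤⟨ *-monoˡ-≤ W (≤-trans (≤-reflexive (sym (*-identityˡ d))) (*-monoˡ-≤ d 1≤h)) ⟩
    (h * d) * W        ∎
    where
    open ≤-Reasoning
    shuffle : ∀ q d k → q * (d * k) ≡ d * (q * k)
    shuffle = solve-∀

  usage : ∀ (q : ℕ → Bool) New U d m x → length New ≤ d * k → (2 * Q) * count q U ≤ x * W → x + h * d ≤ m →
    (2 * Q) * count q (New ++ U) ≤ m * W
  usage q New U d m x len h₁ h₂ = begin
    (2 * Q) * count q (New ++ U)                   ≡⟨ cong ((2 * Q) *_) (count-++ q New U) ⟩
    (2 * Q) * (count q New + count q U)            ≡⟨ *-distribˡ-+ (2 * Q) (count q New) (count q U) ⟩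
    (2 * Q) * count q New + (2 * Q) * count q U    ≤⟨ +-mono-≤ (≤-trans (*-monoʳ-≤ (2 * Q) (≤-trans (count≤length q New) len)) (2Qkd≤ d)) h₁ ⟩
    (h * d) * W + x * W                            ≡⟨ sym (*-distribʳ-+ W (h * d) x) ⟩
    (h * d + x) * W                                ≤⟨ *-monoˡ-≤ W (≤-trans (≤-reflexive (+-comm (h * d) x)) h₂) ⟩
    m * W                                          ∎
    where open ≤-Reasoning

  usage-none : ∀ (q : ℕ → Bool) New U m x → (∀ {y} → y ∈ New → q y ≡ false) →
    (2 * Q) * count q U ≤ x * W → x ≤ m → (2 * Q) * count q (New ++ U) ≤ m * W
  usage-none q New U m x none h₁ h₂ = ≤-trans
    (≤-reflexive (cong ((2 * Q) *_) (≡.trans (count-++ q New U) (cong (_+ count q U) (count-none New none)))))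
    (≤-trans h₁ (*-monoˡ-≤ W h₂))

  ≰ᵇ : ∀ {x y} → y < x → (x ≤ᵇ y) ≡ false
  ≰ᵇ {x} {y} y<x with x ≤ᵇ y in e
  ... | true  = contradiction (true-≤ᵇ {x} e) (<⇒≱ y<x)
  ... | false = refl

  extend : ∀ {t U} d New → t + d ≤ n → State t U → length New ≤ d * k → Within t d New →
    Unique (New ++ U) → State (t + d) (New ++ U)
  extend {t} {U} d New le st len within un = record
    { right = right′ ; left = left′ ; unique = un ; bounded = [ fromNew , bounded ]′ ∘ ∈-++⁻ New }
    where
    open State st
    fromNew : ∀ {u} → u ∈ New → u < N
    fromNew u∈ = <-≤-trans (proj₂ (within u∈)) (upper′-N t d le)
    right′ : ∀ x → (2 * Q) * count (x * W ≤ᵇ_) (New ++ U) ≤ (upper (t + d) ∸ x) * W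
    -- Up to `upper′` a suffix gains the budget of at least `h * d` cells, which pays for all new
    -- sets; beyond it the suffix contains none of them.
    right′ x with ≤-total x (upper′ t d)
    ... | inj₁ x≤ = usage (x * W ≤ᵇ_) New U d (upper (t + d) ∸ x) (upper t ∸ x) len (right x)
      (≤-trans (∸-grow (upper t) (h * d) x x≤) (≤-reflexive (cong (_∸ x) (sym (upper-+ t d)))))
    ... | inj₂ ≤x = usage-none (x * W ≤ᵇ_) New U (upper (t + d) ∸ x) (upper t ∸ x)
      (λ y∈ → ≰ᵇ (<-≤-trans (proj₂ (within y∈)) (*-monoˡ-≤ W ≤x))) (right x)
      (∸-monoˡ-≤ x (upper-mono (m≤m+n t d)))
    left′ : ∀ x → (2 * Q) * count (_<ᵇ x * W) (New ++ U) ≤ (x ∸ lower (t + d)) * W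
    left′ x with ≤-total (lower′ t d) x
    ... | inj₁ ≤x = usage (_<ᵇ x * W) New U d (x ∸ lower (t + d)) (x ∸ lower t) len (left x)
      (≤-trans (≤-reflexive (cong (λ z → x ∸ z + h * d) (lower-+ t d le))) (∸-shrink (lower (t + d)) (h * d) x ≤x))
    ... | inj₂ x≤ = usage-none (_<ᵇ x * W) New U (x ∸ lower (t + d)) (x ∸ lower t)
      (λ y∈ → ≰ᵇ (s≤s (≤-trans (*-monoˡ-≤ W x≤) (proj₁ (within y∈))))) (left x)
      (∸-monoʳ-≤ x (lower-anti (m≤m+n t d)))

  -- Sets for the roots of a forest whose trees are completed one after the
  -- other, starting at time t.
  data Tops (X : List ℕ) : Forest → ℕ → Set where
    leaf : ∀ {t} → Tops X leaf t
    node : ∀ {b c r t} Y → length Y ≡ k → Joined b X Y → Ready t (degᶠ c) Y →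
      Tops X r (t + (degᶠ c + inner c)) → Tops X (node b c r) t

  -- Later roots come first, as in the list `New` that `place` accumulates.
  tops : ∀ {X f t} → Tops X f t → List ℕ
  tops leaf             = []
  tops (node Y _ _ _ τ) = tops τ ++ Y

  data Emb (X : List ℕ) : Forest → Set where
    leaf : Emb X leaf
    node : ∀ {b c r} Y → length Y ≡ k → Joined b X Y → Emb Y c → Emb X r → Emb X (node b c r)

  verts : ∀ {X f} → Emb X f → List ℕ
  verts leaf             = []
  verts (node Y _ _ e ε) = verts ε ++ (verts e ++ Y)

  module _ {t d X U} (ready : Ready t d X) (le : t + d ≤ n) (st : State t U) where
    open Ready ready
    open State st

    -- The whole stage runs against the state before it. The windows of `ready` exceed the old
    -- region by `h * d` cells, and this pays for the siblings in `New`. The start `t′` advances by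
    -- the number of proper descendants of each child, which fixes when that child's own children
    -- will come. A vertex without children has `d = 0`, hence the disjunction.
    place : ∀ r New t′ → length New + degᶠ r * k ≤ d * k → 1 ≤ d ⊎ r ≡ leaf → t + d ≤ t′ → t′ + inner r ≤ n →
      Within t d New → Unique (New ++ U) →
      ∃ λ (τ : Tops X r t′) → length (tops τ) ≡ degᶠ r * k × Within t d (tops τ) × Unique (tops τ ++ (New ++ U))
    place leaf New t′ _ _ _ _ _ un = leaf , refl , (λ ()) , un
    place (node b c r) New t′ len (inj₂ ()) le′ le″ within un
    place (node b c r) New t′ len (inj₁ 1≤d) le′ le″ within un = after
        (place-child ready 1≤d le b (New ++ U)
          (usage (suc cell * W ≤ᵇ_) New U d mₒ (upper t ∸ suc cell) lenNew (right (suc cell)) right-room)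
          (usage (_<ᵇ cell * W) New U d mᵢ (cell ∸ lower t) lenNew (left cell) left-room)
          t′ (degᶠ c) le′ (≤-trans (+-monoʳ-≤ t′ (≤-trans (m≤m+n (degᶠ c) (inner c)) (m≤m+n _ (inner r)))) le″))
      where
      lenNew : length New ≤ d * k
      lenNew = m+n≤o⇒m≤o (length New) len
      right-room : (upper t ∸ suc cell) + h * d ≤ mₒ
      right-room = +-cancelˡ-≤ (suc cell) _ _ (≤-trans
        (≤-reflexive (≡.trans (sym (+-assoc (suc cell) (upper t ∸ suc cell) (h * d))) (cong (_+ h * d) (m+[n∸m]≡n <upper))))
        (≤-reflexive (sym mₒ≡)))
      left-room : (cell ∸ lower t) + h * d ≤ mᵢ
      left-room = +-cancelˡ-≤ (lower′ t d) _ _ (≤-trans (≤-reflexive (≡.trans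
        (swap₄ (lower (t + d)) (h * d) (cell ∸ lower t))
        (≡.trans (cong (_+ (cell ∸ lower t)) (sym (lower-+ t d le))) (m+[n∸m]≡n lower≤)))) (≤-reflexive (sym mᵢ≡)))
        where
        swap₄ : ∀ l g z → (l + g) + (z + g) ≡ (l + (g + g)) + z
        swap₄ = solve-∀
      after : Child b X t d (New ++ U) t′ (degᶠ c) → _
      after (Y , lenY , unY , Y∉ , J , withinY , readyY) = finish (place r (Y ++ New) (t′ + (degᶠ c + inner c))
          (≤-trans (≤-reflexive len-eq) len) (inj₁ 1≤d) (≤-trans le′ (m≤m+n t′ _))
          (≤-trans (≤-reflexive (+-assoc t′ (degᶠ c + inner c) (inner r))) le″)
          ([ withinY , within ]′ ∘ ∈-++⁻ Y)
          (subst Unique (sym (++-assoc Y New U)) (Unique-++⁺ unY un (λ { (y∈ , y∈′) → Y∉ y∈ y∈′ }))))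
        where
        len-eq : length (Y ++ New) + degᶠ r * k ≡ length New + suc (degᶠ r) * k
        len-eq = ≡.trans (cong (_+ degᶠ r * k) (≡.trans (length-++ Y) (≡.trans (cong (_+ length New) lenY) (+-comm k (length New)))))
          (+-assoc (length New) k (degᶠ r * k))
        finish : (∃ λ (τ : Tops X r (t′ + (degᶠ c + inner c))) → length (tops τ) ≡ degᶠ r * k × Within t d (tops τ) ×
            Unique (tops τ ++ ((Y ++ New) ++ U))) →
          ∃ λ (τ : Tops X (node b c r) t′) → length (tops τ) ≡ suc (degᶠ r) * k × Within t d (tops τ) ×
            Unique (tops τ ++ (New ++ U))
        finish (τ , lenτ , withinτ , unτ) = node Y lenY J readyY τ ,
          ≡.trans (length-++ (tops τ)) (≡.trans (cong₂ _+_ lenτ lenY) (+-comm (degᶠ r * k) k)) ,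
          [ withinτ , withinY ]′ ∘ ∈-++⁻ (tops τ) ,
          subst Unique (≡.trans (cong (tops τ ++_) (++-assoc Y New U)) (sym (++-assoc (tops τ) Y (New ++ U)))) unτ

  -- In use the roots listed by `τ` already belong to `U`; only the rest of the forest is new, so
  -- time advances by `inner f`.
  Processed : List ℕ → ∀ {X f t} → Tops X f t → Set
  Processed U {X} {f} {t} τ = ∃ λ (e : Emb X f) → ∃ λ new →
    State (t + inner f) (new ++ U) × verts e ↭ new ++ tops τ

  medial : ∀ (a b c d : List ℕ) → (a ++ b) ++ (c ++ d) ↭ (a ++ c) ++ (b ++ d)
  medial = CommutativeSemigroupProperties.interchange
    (CommutativeMonoid.commutativeSemigroup (++-commutativeMonoid {A = ℕ}))

  -- Depth-first order: the children of the first root, then everything below them, then the sibling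
  -- trees. The starting times so obtained are those recorded in `Tops`.
  process : ∀ f {X t} U (τ : Tops X f t) → t + inner f ≤ n → State t U → Processed U τ
  process leaf {t = t} U leaf le st = leaf , [] , subst (λ z → State z U) (sym (+-identityʳ t)) st , ↭-refl
  process (node b c r) {X} {t} U (node Y lenY J readyY τ) le st =
      placed (place readyY le₁ st c [] (t + degᶠ c) ≤-refl (leaf? c) ≤-refl le₂ (λ ()) unique)
    where
    open State st
    le₃ : t + (degᶠ c + inner c) + inner r ≤ n
    le₃ = ≤-trans (≤-reflexive (+-assoc t (degᶠ c + inner c) (inner r))) le
    le₂ : t + degᶠ c + inner c ≤ n
    le₂ = ≤-trans (≤-reflexive (+-assoc t (degᶠ c) (inner c))) (m+n≤o⇒m≤o (t + (degᶠ c + inner c)) le₃)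
    le₁ : t + degᶠ c ≤ n
    le₁ = m+n≤o⇒m≤o (t + degᶠ c) le₂
    placed : (∃ λ (τ′ : Tops Y c (t + degᶠ c)) → length (tops τ′) ≡ degᶠ c * k × Within t (degᶠ c) (tops τ′) ×
      Unique (tops τ′ ++ U)) → Processed U (node {b = b} Y lenY J readyY τ)
    placed (τ′ , len′ , within′ , un′) = child (process c (tops τ′ ++ U) τ′ le₂
        (extend (degᶠ c) (tops τ′) le₁ st (≤-reflexive len′) within′ un′))
      where
      child : Processed (tops τ′ ++ U) τ′ → Processed U (node {b = b} Y lenY J readyY τ)
      child (e , new , st′ , p) = siblings (process r (new ++ (tops τ′ ++ U)) τ le₃
          (subst (λ z → State z (new ++ (tops τ′ ++ U))) (+-assoc t (degᶠ c) (inner c)) st′))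
        where
        siblings : Processed (new ++ (tops τ′ ++ U)) τ → Processed U (node {b = b} Y lenY J readyY τ)
        siblings (e′ , new′ , st″ , p′) = node Y lenY J e e′ , new′ ++ (new ++ tops τ′) ,
          subst₂ State (+-assoc t (degᶠ c + inner c) (inner r))
            (≡.trans (cong (new′ ++_) (sym (++-assoc new (tops τ′) U))) (sym (++-assoc new′ (new ++ tops τ′) U))) st″ ,
          ↭-trans (++⁺ p′ (++⁺ʳ Y p)) (medial new′ (tops τ) (new ++ tops τ′) Y)

  initial : State 0 []
  initial = record
    { right = λ x → ≤-trans (≤-reflexive (*-zeroʳ (2 * Q))) z≤n
    ; left = λ x → ≤-trans (≤-reflexive (*-zeroʳ (2 * Q))) z≤n
    ; unique = [] ; bounded = λ () }

  Joined-[] : ∀ b {Y} → Joined b [] Y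
  Joined-[] true  ()
  Joined-[] false ()

  -- The root is treated as a child of the empty set, to which everything is joined, so `b` is
  -- arbitrary. At time 0 the region is empty, and the root goes to the cell just right of the
  -- centre.
  embed : ∀ b f → suc (degᶠ f + inner f) ≤ n →
    ∃ λ (e : Emb [] (node b f leaf)) → Unique (verts e) × (∀ {v} → v ∈ verts e → v < N)
  embed b f le = rooted (settle 0 1 ≤-refl 1≤n (lower 0)
      (≤-trans (+-monoʳ-≤ (lower 1) (m≤m+n (h * 1) (h * 1))) (≤-reflexive (sym (lower-+ 0 1 1≤n))))
      (≤-trans (≤-reflexive (+-comm 1 (lower 0)))
        (+-mono-≤ (*-monoʳ-≤ (h + h) (m≤m+n n 0)) (*-mono-≤ 1≤h (≤-refl {1}))))
      (λ _ → true) (≤-trans s≤W (≤-reflexive (sym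
        (≡.trans (count-all (range (lower 0 * W) W) (λ _ → refl)) (length-range (lower 0 * W) W)))))
      1 (degᶠ f) ≤-refl (≤-trans (s≤s (m≤m+n (degᶠ f) (inner f))) le))
    where
    1≤n : 1 ≤ n
    1≤n = m+n≤o⇒m≤o 1 le
    Goal : Set
    Goal = ∃ λ (e : Emb [] (node b f leaf)) → Unique (verts e) × (∀ {v} → v ∈ verts e → v < N)
    rooted : (∃ λ Y → length Y ≡ k × Unique Y × (∀ {z} → z ∈ Y → z ∈ range (lower 0 * W) W × true ≡ true) ×
      Within 0 1 Y × Ready 1 (degᶠ f) Y) → Goal
    rooted (Y , lenY , unY , _ , within , ready) = finish
        (process (node b f leaf) (Y ++ []) root
          (≤-trans (≤-reflexive (cong suc (+-identityʳ (degᶠ f + inner f)))) le)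
          (extend 1 Y 1≤n initial (≤-reflexive (≡.trans lenY (sym (*-identityˡ k)))) within
            (subst Unique (sym (++-identityʳ Y)) unY)))
      where
      root : Tops [] (node b f leaf) 1
      root = node Y lenY (Joined-[] b) ready leaf
      finish : Processed (Y ++ []) root → Goal
      finish (e , new , st , p) = e ,
          Unique-resp-↭ (≡.setoid ℕ) (↭⇒↭ₛ (↭-sym p′)) unique , (λ v∈ → bounded (∈-resp-↭ p′ v∈))
        where
        open State st
        p′ : verts e ↭ new ++ (Y ++ [])
        p′ = ↭-trans p (↭-reflexive (cong (new ++_) (sym (++-identityʳ Y))))

  -- Reading off the set of each tree vertex.

  get : ∀ {X f} → Emb X f → Pos f → List ℕ
  get (node Y _ _ _ _) here     = Y
  get (node _ _ _ e _) (down p) = get e p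
  get (node _ _ _ _ ε) (next p) = get ε p

  get-length : ∀ {X f} (e : Emb X f) p → length (get e p) ≡ k
  get-length (node _ len _ _ _) here     = len
  get-length (node _ _ _ e _)   (down p) = get-length e p
  get-length (node _ _ _ _ ε)   (next p) = get-length ε p

  get-verts : ∀ {X f v} (e : Emb X f) p → v ∈ get e p → v ∈ verts e
  get-verts (node _ _ _ e ε) here     v∈ = ∈-++⁺ʳ (verts ε) (∈-++⁺ʳ (verts e) v∈)
  get-verts (node _ _ _ e ε) (down p) v∈ = ∈-++⁺ʳ (verts ε) (∈-++⁺ˡ (get-verts e p v∈))
  get-verts (node _ _ _ e ε) (next p) v∈ = ∈-++⁺ˡ (get-verts ε p v∈)

  get-unique : ∀ {X f} (e : Emb X f) → Unique (verts e) → ∀ p → Unique (get e p)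
  get-unique (node Y _ _ e ε) un p with Unique-++ {xs = verts ε} un
  ... | uε , u , _ with Unique-++ {xs = verts e} u
  get-unique (node Y _ _ e ε) un here     | _ | _ , uY , _ = uY
  get-unique (node Y _ _ e ε) un (down p) | _ | ue , _ , _ = get-unique e ue p
  get-unique (node Y _ _ e ε) un (next p) | uε , _ | _ = get-unique ε uε p

  get-disjoint : ∀ {X f v} (e : Emb X f) → Unique (verts e) → ∀ p q → v ∈ get e p → v ∈ get e q → p ≡ q
  get-disjoint {v = v} E@(node Y _ _ e ε) un p q v∈ v∈′ with Unique-++ {xs = verts ε} un
  ... | uε , u , d with Unique-++ {xs = verts e} u
  ... | ue , uY , d′ = go p q v∈ v∈′
    where
    go : ∀ p q → v ∈ get E p → v ∈ get E q → p ≡ q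
    go here     here     _  _   = refl
    go here     (down q) v∈ v∈′ = contradiction v∈ (d′ (get-verts e q v∈′))
    go here     (next q) v∈ v∈′ = contradiction (∈-++⁺ʳ (verts e) v∈) (d (get-verts ε q v∈′))
    go (down p) here     v∈ v∈′ = contradiction v∈′ (d′ (get-verts e p v∈))
    go (down p) (down q) v∈ v∈′ = cong down (get-disjoint e ue p q v∈ v∈′)
    go (down p) (next q) v∈ v∈′ = contradiction (∈-++⁺ˡ (get-verts e p v∈)) (d (get-verts ε q v∈′))
    go (next p) here     v∈ v∈′ = contradiction (∈-++⁺ʳ (verts e) v∈′) (d (get-verts ε p v∈))
    go (next p) (down q) v∈ v∈′ = contradiction (∈-++⁺ˡ (get-verts e q v∈′)) (d (get-verts ε p v∈))
    go (next p) (next q) v∈ v∈′ = cong next (get-disjoint ε uε p q v∈ v∈′)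

  get-Top : ∀ {X f b q} (e : Emb X f) → Top b q → Joined b X (get e q)
  get-Top (node _ _ J _ _) here     = J
  get-Top (node _ _ _ _ ε) (next τ) = get-Top ε τ

  get-Below : ∀ {X f b p q} (e : Emb X f) → Below b p q → Joined b (get e p) (get e q)
  get-Below (node _ _ _ e _) (here τ) = get-Top e τ
  get-Below (node _ _ _ e _) (down β) = get-Below e β
  get-Below (node _ _ _ _ ε) (next β) = get-Below ε β

-- Attaching a leaf to a forest.

-- The leaf becomes the first child; the former children of its parent each move one place on,
-- whence `down (next q)` in `old`.
attach : ∀ {f} → Pos f → Bool → Forest
attach {node d c r} here     b = node d (node b leaf c) r
attach {node d c r} (down p) b = node d (attach p b) r
attach {node d c r} (next p) b = node d c (attach p b)

old : ∀ {f} (p : Pos f) b → Pos f → Pos (attach p b)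
old here     b here     = here
old here     b (down q) = down (next q)
old here     b (next q) = next q
old (down p) b here     = here
old (down p) b (down q) = down (old p b q)
old (down p) b (next q) = next q
old (next p) b here     = here
old (next p) b (down q) = down q
old (next p) b (next q) = next (old p b q)

new : ∀ {f} (p : Pos f) b → Pos (attach p b)
new here     b = down here
new (down p) b = down (new p b)
new (next p) b = next (new p b)

down-injective : ∀ {b c r} {p q : Pos c} → down {b} {c} {r} p ≡ down q → p ≡ q
down-injective refl = refl

next-injective : ∀ {b c r} {p q : Pos r} → next {b} {c} {r} p ≡ next q → p ≡ q
next-injective refl = refl

old-injective : ∀ {f} (p : Pos f) b {q q′} → old p b q ≡ old p b q′ → q ≡ q′
old-injective here     b {here}   {here}    _ = refl
old-injective here     b {down q} {down q′} refl = refl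
old-injective here     b {next q} {next q′} refl = refl
old-injective (down p) b {here}   {here}    _ = refl
old-injective (down p) b {down q} {down q′} e = cong down (old-injective p b (down-injective e))
old-injective (down p) b {next q} {next q′} refl = refl
old-injective (next p) b {here}   {here}    _ = refl
old-injective (next p) b {down q} {down q′} refl = refl
old-injective (next p) b {next q} {next q′} e = cong next (old-injective p b (next-injective e))

new≢old : ∀ {f} (p : Pos f) b q → new p b ≢ old p b q
new≢old here     b here     ()
new≢old here     b (down q) ()
new≢old here     b (next q) ()
new≢old (down p) b here     ()
new≢old (down p) b (next q) ()
new≢old (next p) b here     ()
new≢old (next p) b (down q) ()
new≢old (down p) b (down q) e = new≢old p b q (down-injective e)
new≢old (next p) b (next q) e = new≢old p b q (next-injective e)

Top-old : ∀ {f d} (p : Pos f) b {q} → Top d q → Top d (old p b q)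
Top-old here     b here     = here
Top-old here     b (next τ) = next τ
Top-old (down p) b here     = here
Top-old (down p) b (next τ) = next τ
Top-old (next p) b here     = here
Top-old (next p) b (next τ) = next (Top-old p b τ)

Below-old : ∀ {f d} (p : Pos f) b {q q′} → Below d q q′ → Below d (old p b q) (old p b q′)
Below-old here     b (here τ) = here (next τ)
Below-old here     b (down β) = down (next β)
Below-old here     b (next β) = next β
Below-old (down p) b (here τ) = here (Top-old p b τ)
Below-old (down p) b (down β) = down (Below-old p b β)
Below-old (down p) b (next β) = next β
Below-old (next p) b (here τ) = here τ
Below-old (next p) b (down β) = down β
Below-old (next p) b (next β) = next (Below-old p b β)

Below-new : ∀ {f} (p : Pos f) b → Below b (old p b p) (new p b)
Below-new here     b = here here
Below-new (down p) b = down (Below-new p b)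
Below-new (next p) b = next (Below-new p b)

degᶠ-attach : ∀ {f} (p : Pos f) b → degᶠ (attach p b) ≡ degᶠ f
degᶠ-attach here     b = refl
degᶠ-attach (down p) b = refl
degᶠ-attach (next p) b = cong suc (degᶠ-attach p b)

inner-attach : ∀ {f} (p : Pos f) b → inner (attach p b) ≡ suc (inner f)
inner-attach here     b = refl
inner-attach {node d c r} (down p) b = cong (_+ inner r)
  (≡.trans (cong₂ _+_ (degᶠ-attach p b) (inner-attach p b)) (+-suc (degᶠ c) (inner c)))
inner-attach {node d c r} (next p) b =
  ≡.trans (cong (degᶠ c + inner c +_) (inner-attach p b)) (+-suc (degᶠ c + inner c) (inner r))

lookup-injective : ∀ {A : Set} {xs : List A} → Unique xs → ∀ {i j} → lookup xs i ≡ lookup xs j → i ≡ j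
lookup-injective (_ ∷ _)   {zero}  {zero}  _ = refl
lookup-injective {xs = x ∷ xs} (x∉ ∷ _)  {zero}  {suc j} e = contradiction e (All.lookup x∉ (∈-lookup j))
lookup-injective {xs = x ∷ xs} (x∉ ∷ _)  {suc i} {zero}  e = contradiction (sym e) (All.lookup x∉ (∈-lookup i))
lookup-injective (_ ∷ un)  {suc i} {suc j} e = cong suc (lookup-injective un e)

-- Paths and cycles.

module _ {n : ℕ} (F : Digraph n) where

  -- The vertex list is an index so that `lookup` can serve as the vertex map of a cycle.
  data Path : Fin n → Fin n → List (Fin n) → Set where
    stop : ∀ {x} → Path x x [ x ]
    edge : ∀ {x y z l} → Adj F x y → x ∉ l → Path y z l → Path x z (x ∷ l)

  Path-unique : ∀ {x y l} → Path x y l → Unique l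
  Path-unique stop          = [] ∷ []
  Path-unique (edge a x∉ π) = All.tabulate (λ y∈ x≡y → x∉ (subst (_∈ _) (sym x≡y) y∈)) ∷ Path-unique π

  Path-snoc : ∀ {x y z l} → Path x y l → Adj F y z → z ∉ l → Path x z (l ++ [ z ])
  Path-snoc stop a z∉ = edge a (λ { (here e) → z∉ (here (sym e)) }) stop
  Path-snoc {l = x ∷ l} (edge a′ x∉ π) a z∉ =
    edge a′ ([ x∉ , (λ { (here e) → z∉ (here (sym e)) }) ]′ ∘ ∈-++⁻ l) (Path-snoc π a (z∉ ∘ there))

  Path-last : ∀ {x y z l} → Path x y (z ∷ l) → lookup (z ∷ l) (fromℕ (length l)) ≡ y
  Path-last stop                         = refl
  Path-last {l = _ ∷ _} (edge _ _ π) = Path-last π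

  Path-adjacent : ∀ {x y z l} → Path x y (z ∷ l) → ∀ i →
    Adj F (lookup (z ∷ l) (inject₁ i)) (lookup (z ∷ l) (suc i))
  Path-adjacent (edge a _ stop)           zero    = a
  Path-adjacent (edge a _ (edge _ _ _))     zero    = a
  Path-adjacent {l = _ ∷ _} (edge _ _ π)   (suc i) = Path-adjacent π i

  Path-cycle : ∀ {x y l} → Path x y l → 3 ≤ length l → Adj F y x → ∃ λ m → Cycle F m
  Path-cycle {l = []}        _ ()
  Path-cycle {l = _ ∷ []}    _ (s≤s ())
  Path-cycle {l = _ ∷ _ ∷ []} _ (s≤s (s≤s ()))
  Path-cycle {x} {y} {l = x ∷ v ∷ w ∷ l} π@(edge _ _ _) _ a =
    length l , lookup (x ∷ v ∷ w ∷ l) , lookup-injective (Path-unique π) , Path-adjacent π ,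
    subst (λ z → Adj F z x) (sym (Path-last π)) a

-- Rooting an oriented tree.

module TreeForest {n : ℕ} (F : Digraph n) (oriented : IsOriented F) (acyclic : Acyclic F) where

  -- The visited part of the tree as a one-rooted forest. `place` is total, with arbitrary values
  -- outside `vis`; `path` records connectedness inside `vis`, from which a chord would yield a
  -- cycle.
  record Grown (vis : List (Fin n)) : Set where
    field
      forest   : Forest
      rooted   : degᶠ forest ≡ 1
      size     : suc (inner forest) ≡ length vis
      place    : Fin n → Pos forest
      place-injective : ∀ {x y} → x ∈ vis → y ∈ vis → place x ≡ place y → x ≡ y
      arcs     : ∀ {x y} → x ∈ vis → y ∈ vis → F x y →
        Below true (place x) (place y) ⊎ Below false (place y) (place x)
      unique   : Unique vis
      path     : ∀ {x y} → x ∈ vis → y ∈ vis → ∃ λ l → Path F x y l × (∀ {z} → z ∈ l → z ∈ vis)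

  single : ∀ x → Grown [ x ]
  single x = record
    { forest = node true leaf leaf ; rooted = refl ; size = refl ; place = λ _ → here
    ; place-injective = λ { (here refl) (here refl) _ → refl }
    ; arcs = λ { (here refl) (here refl) a → contradiction a (proj₁ oriented _) }
    ; unique = [] ∷ []
    ; path = λ { (here refl) (here refl) → [ x ] , stop , λ z∈ → z∈ } }

  module _ {vis} (g : Grown vis) {u w} (u∈ : u ∈ vis) (w∉ : w ∉ vis) (adj : Adj F u w) where
    open Grown g

    -- A second neighbour `x` of `w` would close the path from `u` to `x` inside `vis` into a cycle
    -- through `w`.
    no-chord : ∀ {x} → x ∈ vis → Adj F w x → x ≡ u
    no-chord {x} x∈ a with x ≟ᶠ u
    ... | yes e = e
    ... | no x≢u with path u∈ x∈
    ... | _ , stop , _ = contradiction refl x≢u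
    -- Matching on the path exposes two vertices, so that together with `w` the cycle has at least
    -- three.
    ... | _ , π@(edge _ _ stop) , l⊆ =
      contradiction (proj₂ c) (acyclic (proj₁ c))
      where c = Path-cycle F (edge (⊎-swap adj) (w∉ ∘ l⊆) π) (s≤s (s≤s (s≤s z≤n))) (⊎-swap a)
    ... | _ , π@(edge _ _ (edge _ _ _)) , l⊆ =
      contradiction (proj₂ c) (acyclic (proj₁ c))
      where c = Path-cycle F (edge (⊎-swap adj) (w∉ ∘ l⊆) π) (s≤s (s≤s (s≤s z≤n))) (⊎-swap a)

    leaves : Adj F u w → Bool
    leaves (inj₁ _) = true
    leaves (inj₂ _) = false

    b : Bool
    b = leaves adj

    place′ : Fin n → Pos (attach (place u) b)
    place′ v with v ≟ᶠ w
    ... | yes _ = new (place u) b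
    ... | no  _ = old (place u) b (place v)

    place′-new : place′ w ≡ new (place u) b
    place′-new with w ≟ᶠ w
    ... | yes _ = refl
    ... | no w≢ = contradiction refl w≢

    place′-old : ∀ {x} → x ∈ vis → place′ x ≡ old (place u) b (place x)
    place′-old {x} x∈ with x ≟ᶠ w
    ... | yes refl = contradiction x∈ w∉
    ... | no _     = refl

    arcs-new : Below b (place′ u) (place′ w)
    arcs-new rewrite place′-new | place′-old u∈ = Below-new (place u) b

    -- As `b` is computed from `adj`, the adjacency is generalised in `go`; its opposite case
    -- contradicts the orientation.
    into-new : F u w → Below true (place′ u) (place′ w)
    into-new a = go adj arcs-new
      where
      go : (a′ : Adj F u w) → Below (leaves a′) (place′ u) (place′ w) → Below true (place′ u) (place′ w)
      go (inj₁ _)  β = β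
      go (inj₂ a′) _ = contradiction a′ (proj₂ oriented _ _ a)

    from-new : F w u → Below false (place′ u) (place′ w)
    from-new a = go adj arcs-new
      where
      go : (a′ : Adj F u w) → Below (leaves a′) (place′ u) (place′ w) → Below false (place′ u) (place′ w)
      go (inj₁ a′) _ = contradiction a′ (proj₂ oriented _ _ a)
      go (inj₂ _)  β = β

    place′-injective : ∀ {x y} → x ∈ w ∷ vis → y ∈ w ∷ vis → place′ x ≡ place′ y → x ≡ y
    place′-injective (here refl) (here refl) _ = refl
    place′-injective (here refl) (there y∈) e = contradiction
      (≡.trans (sym place′-new) (≡.trans e (place′-old y∈))) (new≢old (place u) b _)
    place′-injective (there x∈) (here refl) e = contradiction
      (≡.trans (sym place′-new) (≡.trans (sym e) (place′-old x∈))) (new≢old (place u) b _)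
    place′-injective (there x∈) (there y∈) e = place-injective x∈ y∈
      (old-injective (place u) b (≡.trans (sym (place′-old x∈)) (≡.trans e (place′-old y∈))))

    arcs′ : ∀ {x y} → x ∈ w ∷ vis → y ∈ w ∷ vis → F x y →
      Below true (place′ x) (place′ y) ⊎ Below false (place′ y) (place′ x)
    arcs′ (here refl) (here refl) a = contradiction a (proj₁ oriented _)
    arcs′ (here refl) (there y∈) a with no-chord y∈ (inj₁ a)
    ... | refl = inj₂ (from-new a)
    arcs′ (there x∈) (here refl) a with no-chord x∈ (inj₂ a)
    ... | refl = inj₁ (into-new a)
    arcs′ (there x∈) (there y∈) a rewrite place′-old x∈ | place′-old y∈ with arcs x∈ y∈ a
    ... | inj₁ β = inj₁ (Below-old (place u) b β)
    ... | inj₂ β = inj₂ (Below-old (place u) b β)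

    path′ : ∀ {x y} → x ∈ w ∷ vis → y ∈ w ∷ vis → ∃ λ l → Path F x y l × (∀ {z} → z ∈ l → z ∈ w ∷ vis)
    path′ (here refl) (here refl) = [ w ] , stop , λ { (here e) → here e }
    path′ (here refl) (there y∈) with path u∈ y∈
    ... | l , π , l⊆ = w ∷ l , (edge (⊎-swap adj) (w∉ ∘ l⊆) π) , λ { (here e) → here e ; (there z∈) → there (l⊆ z∈) }
    path′ (there x∈) (here refl) with path x∈ u∈
    ... | l , π , l⊆ = l ++ [ w ] , Path-snoc F π adj (w∉ ∘ l⊆) ,
      [ there ∘ l⊆ , (λ { (here e) → here e }) ]′ ∘ ∈-++⁻ l
    path′ (there x∈) (there y∈) with path x∈ y∈
    ... | l , π , l⊆ = l , π , there ∘ l⊆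

    grow : Grown (w ∷ vis)
    grow = record
      { forest = attach (place u) b
      ; rooted = ≡.trans (degᶠ-attach (place u) b) rooted
      ; size = cong suc (≡.trans (inner-attach (place u) b) size)
      ; place = place′ ; place-injective = place′-injective ; arcs = arcs′
      ; unique = All.tabulate (λ y∈ w≡y → w∉ (subst (_∈ vis) (sym w≡y) y∈)) ∷ unique
      ; path = path′ }

  reach : ∀ {vis} → Grown vis → ∀ {u v} → u ∈ vis → Walk F u v →
    ∃ λ vis′ → Grown vis′ × v ∈ vis′ × (∀ {x} → x ∈ vis → x ∈ vis′)
  reach g u∈ here = _ , g , u∈ , λ x∈ → x∈
  reach {vis} g u∈ (step {v = w} a walk) with member? _≟ᶠ_ w vis
  ... | yes w∈ = reach g w∈ walk
  ... | no  w∉ with reach (grow g u∈ w∉ a) (here refl) walk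
  ... | vis′ , g′ , v∈ , ⊆′ = vis′ , g′ , v∈ , ⊆′ ∘ there

  reach-all : Connected F → ∀ {vis} → Grown vis → ∀ {u} → u ∈ vis → ∀ ts →
    ∃ λ vis′ → Grown vis′ × (∀ {t} → t ∈ ts → t ∈ vis′) × (∀ {x} → x ∈ vis → x ∈ vis′)
  reach-all conn g u∈ [] = _ , g , (λ ()) , λ x∈ → x∈
  reach-all conn g {u} u∈ (t ∷ ts) with reach g u∈ (conn u t)
  ... | vis₁ , g₁ , t∈ , ⊆₁ with reach-all conn g₁ (⊆₁ u∈) ts
  ... | vis₂ , g₂ , ts⊆ , ⊆₂ = vis₂ , g₂ , (λ { (here refl) → ⊆₂ t∈ ; (there t′∈) → ts⊆ t′∈ }) , ⊆₂ ∘ ⊆₁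

  record Rooted : Set where
    field
      direction : Bool
      below     : Forest
      small     : suc (degᶠ below + inner below) ≤ n
      place     : Fin n → Pos (node direction below leaf)
      place-injective : ∀ {x y} → place x ≡ place y → x ≡ y
      arcs      : ∀ {x y} → F x y → Below true (place x) (place y) ⊎ Below false (place y) (place x)

  root-at : Connected F → Fin n → Rooted
  root-at conn r with reach-all conn (single r) (here refl) (allFin n)
  ... | vis , g , all∈ , _ with Grown.forest g | Grown.rooted g | Grown.size g | Grown.place g
                              | Grown.place-injective g | Grown.arcs g
  -- `degᶠ` equal to 1 leaves only this shape, a single tree whose root has no sibling.
  ... | node d f leaf | refl | size | pl | inj | ar = record
    { direction = d ; below = f
    ; small = ≤-trans (≤-reflexive (≡.trans (cong suc (sym (+-identityʳ (degᶠ f + inner f)))) size))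
        (injective⇒≤ (lookup-injective (Grown.unique g)))
    ; place = pl
    ; place-injective = inj (all∈ (∈-allFin _)) (all∈ (∈-allFin _))
    ; arcs = ar (all∈ (∈-allFin _)) (all∈ (∈-allFin _)) }

-- From positions back to the tournament.

module _ {n k N s Q W h : ℕ} (F : Digraph n) (tree : IsOrientedTree F) (R : Digraph N) (tournament : IsTournament R)
  (root : Fin n) (default : Fin N) (1≤k : 1 ≤ k) (s≡ : s ≡ 8 * k) (Q≡ : Q ≡ 16 * 2 ^ s) (W≡ : W ≡ (2 * Q) * s)
  (8≤h : 8 ≤ h) (N≥ : ((h + h) * (n + n)) * W ≤ N)
  where

  private
    -- Arcs of `R` come without a decision procedure; the totality of the tournament supplies one,
    -- since the disjunction for distinct vertices can be inspected.
    arcᵇ : Fin N → Fin N → Bool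
    arcᵇ u v with u ≟ᶠ v
    ... | yes _  = false
    ... | no u≢v = [ (λ _ → true) , (λ _ → false) ]′ (proj₁ (proj₂ tournament) u v u≢v)

    arcᵇ-sound : ∀ {u v} → arcᵇ u v ≡ true → R u v
    arcᵇ-sound {u} {v} e with u ≟ᶠ v
    ... | no u≢v with proj₁ (proj₂ tournament) u v u≢v
    ... | inj₁ uv = uv

    arcᵇ-complete : ∀ {u v} → R u v → arcᵇ u v ≡ true
    arcᵇ-complete {u} {v} uv with u ≟ᶠ v
    ... | yes refl = contradiction uv (proj₁ tournament u)
    ... | no u≢v with proj₁ (proj₂ tournament) u v u≢v
    ... | inj₁ _  = refl
    ... | inj₂ vu = contradiction vu (proj₂ (proj₂ tournament) u v uv)

    total : ∀ {u v} → u ≢ v → arcᵇ u v ≡ true ⊎ arcᵇ v u ≡ true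
    total {u} {v} u≢v with proj₁ (proj₂ tournament) u v u≢v
    ... | inj₁ uv = inj₁ (arcᵇ-complete uv)
    ... | inj₂ vu = inj₂ (arcᵇ-complete vu)

    open MedianOrder arcᵇ
    open TreeForest F (proj₁ tree) (proj₂ (proj₂ tree))

  module _ (o : List (Fin N)) (o↭ : allFin N ↭ o) (median : LocalMedian o) where

    private
      unique : Unique o
      unique = Unique-resp-↭ (≡.setoid (Fin N)) (↭⇒↭ₛ o↭) (allFin⁺ N)

      length-o : length o ≡ N
      length-o = ≡.trans (sym (↭-length o↭)) (length-tabulate (λ (i : Fin N) → i))

      open Positions total default o unique median
      open Embedding (length o) arc out-median in-median k s Q W h n 1≤k s≡ Q≡ W≡ 8≤h
        (≤-trans N≥ (≤-reflexive (sym length-o)))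
        using (Emb; verts; embed; get; get-length; get-verts; get-unique; get-disjoint; get-Below)
      module FromEmbedding (rooted : Rooted)
        (e : Emb [] (node (Rooted.direction rooted) (Rooted.below rooted) leaf)) (unique-e : Unique (verts e))
        (bounded : ∀ {v} → v ∈ verts e → v < length o) where

        open Rooted rooted using (place; place-injective; arcs)

        toℕ< : ∀ v (i : Fin k) → toℕ i < length (get e (place v))
        toℕ< v i = <-≤-trans (toℕ<n i) (≤-reflexive (sym (get-length e (place v))))

        position : Fin n → Fin k → ℕ
        position v i = nth 0 (get e (place v)) (toℕ i)

        position-∈ : ∀ v i → position v i ∈ get e (place v)
        position-∈ v i = nth-∈ 0 (get e (place v)) (toℕ< v i)

        position-< : ∀ v i → position v i < length o
        position-< v i = bounded (get-verts e (place v) (position-∈ v i))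

        vertex : Fin n × Fin k → Fin N
        vertex (v , i) = nth default o (position v i)

        vertex-injective : ∀ {x y} → vertex x ≡ vertex y → x ≡ y
        vertex-injective {u , i} {v , j} eq = same (place-injective
            (get-disjoint e unique-e (place u) (place v) (position-∈ u i)
              (subst (_∈ get e (place v)) (sym positions≡) (position-∈ v j)))) positions≡
          where
          positions≡ : position u i ≡ position v j
          positions≡ = nth-injective default unique (position-< u i) (position-< v j) eq
          same : u ≡ v → position u i ≡ position v j → (u , i) ≡ (v , j)
          same refl p≡ = cong (u ,_) (toℕ-injective
            (nth-injective 0 (get-unique e unique-e (place u)) (toℕ< u i) (toℕ< u j) p≡))

        vertex-arc : ∀ x y → BlowUp F k x y → R (vertex x) (vertex y)
        vertex-arc (u , i) (v , j) uv = arcᵇ-sound (go (arcs uv))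
          where
          go : Below true (place u) (place v) ⊎ Below false (place v) (place u) →
            arc (position u i) (position v j) ≡ true
          go (inj₁ β) = get-Below e β (position-∈ u i) (position-∈ v j)
          go (inj₂ β) = get-Below e β (position-∈ v j) (position-∈ u i)

        contains : Contains R (BlowUp F k)
        contains = vertex , vertex-injective , vertex-arc

    contains-along : Contains R (BlowUp F k)
    contains-along = build (root-at (proj₁ (proj₂ tree)) root)
      where
      build : Rooted → Contains R (BlowUp F k)
      build ρ = finish (embed (Rooted.direction ρ) (Rooted.below ρ) (Rooted.small ρ))
        where
        finish : (∃ λ (e : Emb [] (node (Rooted.direction ρ) (Rooted.below ρ) leaf)) →
          Unique (verts e) × (∀ {v} → v ∈ verts e → v < length o)) → Contains R (BlowUp F k)
        finish (e , unique-e , bounded) = FromEmbedding.contains ρ e unique-e bounded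

  contains-blow-up : Contains R (BlowUp F k)
  contains-blow-up with local-median (backward (allFin N)) (allFin N) ≤-refl
  ... | o , o↭ , median = contains-along o o↭ median

-- The numerical bound.

-- The number of cells is `2 ^ 5 * n` and a cell has `2 ^ 5 * 2 ^ (8 * k) * 2 ^ 3 * k` positions,
-- together `2 ^ (13 + 8 * k) * k * n`; then `3 ≤ 10 * k` suffices.
cells-fit : ∀ n k → 1 ≤ k → ((8 + 8) * (n + n)) * ((2 * (16 * 2 ^ (8 * k))) * (8 * k)) ≤ 2 ^ (10 + 18 * k) * k * n
cells-fit n k 1≤k = begin
  ((8 + 8) * (n + n)) * ((2 * (16 * 2 ^ (8 * k))) * (8 * k)) ≡⟨ collect 8 2 16 (2 ^ (8 * k)) k n ⟩
  ((8 + 8) * 2 * 2 * 16 * 8 * 2 ^ (8 * k)) * k * n           ≡⟨ cong (λ c → c * 2 ^ (8 * k) * k * n) {(8 + 8) * 2 * 2 * 16 * 8} {2 ^ 13} refl ⟩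
  (2 ^ 13 * 2 ^ (8 * k)) * k * n                             ≡⟨ cong (λ c → c * k * n) (sym (^-distribˡ-+-* 2 13 (8 * k))) ⟩
  2 ^ (13 + 8 * k) * k * n                                   ≤⟨ *-monoˡ-≤ n (*-monoˡ-≤ k (^-monoʳ-≤ 2 exponents)) ⟩
  2 ^ (10 + 18 * k) * k * n                                  ∎
  where
  open ≤-Reasoning
  collect : ∀ h a b e k n → ((h + h) * (n + n)) * ((a * (b * e)) * (h * k)) ≡ ((h + h) * 2 * a * b * h * e) * k * n
  collect = solve-∀
  exponents : 13 + 8 * k ≤ 10 + 18 * k
  exponents = +-monoʳ-≤ 10 (≤-trans (+-monoˡ-≤ (8 * k) (≤-trans (≤ᵇ⇒≤ 3 10 _) (*-monoʳ-≤ 10 1≤k)))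
    (≤-reflexive (sym (*-distribʳ-+ k 10 8))))

theorem18 : (n k : ℕ) → 1 ≤ n → 1 ≤ k →
    (F : Digraph n) → IsOrientedTree F →
    (N : ℕ) → 2 ^ (10 + 18 * k) * k * n ≤ N →
    (T : Digraph N) → IsTournament T →
    Contains T (BlowUp F k)
theorem18 n k 1≤n 1≤k F tree N N≥ T tournament =
  -- The choices are `s = 8 k`, `Q = 16 * 2 ^ s`, `W = 2 Q s` and `h = 8`. Positivity of `n`
  -- provides a root, and positivity of `N` the default entry for `nth`.
  contains-blow-up {n} {k} {N} {8 * k} {16 * 2 ^ (8 * k)} {(2 * (16 * 2 ^ (8 * k))) * (8 * k)} {8} F tree T tournament
    (fromℕ< 1≤n) (fromℕ< (≤-trans (*-mono-≤ (*-mono-≤ (m^n>0 2 (10 + 18 * k)) 1≤k) 1≤n) N≥))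
    1≤k refl refl refl ≤-refl (≤-trans (cells-fit n k 1≤k) N≥)
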